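{- The Prime $k$-tuples Conjecture implies that there are infinitely many Lucas-Carmichael integers of degree $4$ with exactly seven prime factors.
   Context: A Lucas-Carmichael integer is a square-free positive composite integer $n$ such that $p+1 \mid n+1$ for every prime $p$ dividing $n$. For an integer $b\ge 2$ and a positive integer $N$, $S_b(N)$ denotes the sum of the base-$b$ digits of $N$. The degree of a Lucas-Carmichael integer $n$ is the integer $\alpha = \max_{p\mid n} \frac{S_{p+2}(n+2)-1}{p+1}$, the maximum being over the prime divisors $p$ of $n$. Prime $k$-tuples Conjecture: Let $a_1,\ldots,a_k$ be positive integers, and let $b_1,\ldots,b_k$ be nonzero integers. For $m\ge 1$, define $f(m)=\prod_{i=1}^k (a_i m+b_i)$. Let $P(x)$ denote the number of positive integers $m\le x$ for which $a_i m+b_i$ is prime for each $i=1,\ldots,k$. The conjecture states that if no prime divides $f(m)$ for every $m$, then there exists $c>0$ such that $P(x)\sim \frac{cx}{\log^k x}$ as $x\to\infty$. -}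

module Defs where

import Algebra.Solver.Ring.AlmostCommutativeRing as ACR
open import Data.Digit using (toDigits)
open import Data.Empty using (⊥)
open import Data.Fin.Base using (Fin; toℕ)
open import Data.Fin.Properties using (all?)
open import Data.Integer.Base as ℤ using (ℤ; +_; -[1+_]; 0ℤ; 1ℤ)
open import Data.Integer.Divisibility as ℤ using ()
import Data.Integer.Properties as ℤ
open import Data.List.Base using (List; applyUpTo; filter; length; map; upTo)
open import Data.List.Extrema.Nat using (max)
import Data.Maybe.Base as Maybe
open import Data.Nat.Base as ℕ using (ℕ; zero; suc; NonZero; NonTrivial)
open import Data.Nat.Divisibility using (_∣_; _∣?_)
open import Data.Nat.ListAction using (sum)
import Data.Nat.Properties as ℕ
open import Data.Nat.Primality using (Prime; prime?; Composite)
open import Data.Product.Base using (∃; _×_; _,_; proj₁; proj₂)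
open import Data.Sum.Base using (inj₁; inj₂)
open import Data.Vec.Functional using (foldr)
open import Function.Definitions using (Injective)
open import Relation.Binary.PropositionalEquality
  using (_≡_; _≢_; refl; sym; trans; cong; cong₂; subst; subst₂; module ≡-Reasoning)
open import Relation.Nullary using (¬_; Dec; yes; no; contradiction)
open import Relation.Nullary.Decidable using (True; dec⇒maybe; _×-dec_)

------------------------------------------------------------------------
-- Real numbers

module Real where

  open import Data.Rational.Base
    using (ℚ; mkℚ; *<*; 0ℚ; 1ℚ; ½; _/_; 1/_; _+_; _*_; _-_; -_; ∣_∣; _≤_; _<_
          ; ≢-nonZero; positive; nonNegative; NonNegative; toℚᵘ)
  open import Data.Rational.Properties
  open import Data.Rational.Unnormalised.Base as ℚᵘ using (mkℚᵘ; *≡*)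
  import Data.Rational.Unnormalised.Properties as ℚᵘ

  private
    toℚᵘ-/ : ∀ i d → toℚᵘ (i / suc d) ℚᵘ.≃ mkℚᵘ i d
    toℚᵘ-/ i d = toℚᵘ-fromℚᵘ (mkℚᵘ i d)

    /1-+ : ∀ i j → (i ℤ.+ j) / 1 ≡ i / 1 + j / 1
    /1-+ i j = toℚᵘ-injective (ℚᵘ.≃-trans (toℚᵘ-/ (i ℤ.+ j) 0) (ℚᵘ.≃-sym
      (ℚᵘ.≃-trans (toℚᵘ-homo-+ (i / 1) (j / 1))
      (ℚᵘ.≃-trans (ℚᵘ.+-cong (toℚᵘ-/ i 0) (toℚᵘ-/ j 0))
      (*≡* (cong (ℤ._* + 1) (cong₂ ℤ._+_ (ℤ.*-identityʳ i) (ℤ.*-identityʳ j))))))))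

    /1-* : ∀ i j → (i ℤ.* j) / 1 ≡ i / 1 * (j / 1)
    /1-* i j = toℚᵘ-injective (ℚᵘ.≃-trans (toℚᵘ-/ (i ℤ.* j) 0) (ℚᵘ.≃-sym
      (ℚᵘ.≃-trans (toℚᵘ-homo-* (i / 1) (j / 1))
        (ℚᵘ.*-cong (toℚᵘ-/ i 0) (toℚᵘ-/ j 0)))))

    /1-neg : ∀ i → (ℤ.- i) / 1 ≡ - (i / 1)
    /1-neg i = toℚᵘ-injective (ℚᵘ.≃-trans (toℚᵘ-/ (ℤ.- i) 0) (ℚᵘ.≃-sym
      (ℚᵘ.≃-trans (toℚᵘ-homo‿- (i / 1)) (ℚᵘ.-‿cong (toℚᵘ-/ i 0)))))

    ℚ-ring = ACR.fromCommutativeRing +-*-commutativeRing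

    ℤ⟶ℚ : ℤ.+-*-rawRing ACR.-Raw-AlmostCommutative⟶ ℚ-ring
    ℤ⟶ℚ = record
      { ⟦_⟧    = _/ 1
      ; +-homo = /1-+
      ; *-homo = /1-*
      ; -‿homo = /1-neg
      ; 0-homo = refl
      ; 1-homo = refl
      }

  -- Integer coefficients: much faster than Data.Rational.Solver.
  open import Algebra.Solver.Ring ℤ.+-*-rawRing ℚ-ring ℤ⟶ℚ
    (λ i j → Maybe.map (cong (_/ 1)) (dec⇒maybe (i ℤ.≟ j)))
    using (solve; _:=_; _:+_; _:*_; _:-_; :-_; con)

  private
    0<1 : 0ℚ < 1ℚ
    0<1 = positive⁻¹ 1ℚ

    <⇒nonNeg : ∀ {p} → 0ℚ < p → NonNegative p
    <⇒nonNeg 0<p = nonNegative (<⇒≤ 0<p)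

    *-pos : ∀ {p q} → 0ℚ < p → 0ℚ < q → 0ℚ < p * q
    *-pos {p} {q} 0<p 0<q =
      positive⁻¹ (p * q) {{pos*pos⇒pos p {{positive 0<p}} q {{positive 0<q}}}}

    *-mono-nonNeg : ∀ {p q r s} → 0ℚ ≤ r → 0ℚ ≤ q → p ≤ q → r ≤ s → p * r ≤ q * s
    *-mono-nonNeg {p} {q} {r} {s} 0≤r 0≤q p≤q r≤s = ≤-trans
      (*-monoʳ-≤-nonNeg r {{nonNegative 0≤r}} p≤q)
      (*-monoˡ-≤-nonNeg q {{nonNegative 0≤q}} r≤s)

    -‿mono : ∀ {p q r} → p ≤ q + r → p - q ≤ r
    -‿mono {p} {q} {r} h = subst (p - q ≤_)
      (solve 2 (λ q r → q :+ r :- q := r) refl q r) (+-monoˡ-≤ (- q) h)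

    ≤-from-- : ∀ {p q r} → p - q ≤ r → p ≤ r + q
    ≤-from-- {p} {q} {r} h = subst (_≤ r + q)
      (solve 2 (λ p q → p :- q :+ q := p) refl p q) (+-monoˡ-≤ q h)

    ∣∣≤ : ∀ {p q} → p ≤ q → - p ≤ q → ∣ p ∣ ≤ q
    ∣∣≤ {p} p≤q -p≤q with ∣p∣≡p∨∣p∣≡-p p
    ... | inj₁ e = subst (_≤ _) (sym e) p≤q
    ... | inj₂ e = subst (_≤ _) (sym e) -p≤q

    ∣∣-nearby : ∀ p q → ∣ p ∣ - ∣ q ∣ ≤ ∣ p - q ∣
    ∣∣-nearby p q = -‿mono (subst₂ (λ u v → ∣ u ∣ ≤ v)
      (solve 2 (λ p q → p :- q :+ q := p) refl p q)
      (+-comm ∣ p - q ∣ ∣ q ∣)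
      (∣p+q∣≤∣p∣+∣q∣ (p - q) q))

    half : ∀ {ε} → 0ℚ < ε → 0ℚ < ½ * ε
    half = *-pos (positive⁻¹ ½)

    half+half : ∀ ε → ½ * ε + ½ * ε ≡ ε
    half+half ε = trans (sym (*-distribʳ-+ ε ½ ½)) (*-identityˡ ε)

  -- Finitely many approximations of a positive real may vanish, so the
  -- reciprocal of a real needs a total reciprocal of rationals.

  recip : ℚ → ℚ
  recip q with q ≟ 0ℚ
  ... | yes _   = 0ℚ
  ... | no  q≢0 = (1/ q) {{≢-nonZero q≢0}}

  recip-inverseʳ : ∀ q → q ≢ 0ℚ → q * recip q ≡ 1ℚ
  recip-inverseʳ q q≢0 with q ≟ 0ℚ
  ... | yes q≡0 = contradiction q≡0 q≢0
  ... | no  q≢0 = *-inverseʳ q {{≢-nonZero q≢0}}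

  recip-pos : ∀ {q} → 0ℚ < q → 0ℚ < recip q
  recip-pos {q} 0<q with q ≟ 0ℚ
  ... | yes q≡0 = contradiction (sym q≡0) (<⇒≢ 0<q)
  ... | no  q≢0 = positive⁻¹ _ {{1/pos⇒pos q {{positive 0<q}}}}

  private
    *-close : ∀ a b c d {C ε} → 0ℚ < C → ∣ a ∣ ≤ C → ∣ d ∣ ≤ C →
              ∣ a - c ∣ ≤ ½ * (ε * recip C) → ∣ b - d ∣ ≤ ½ * (ε * recip C) →
              ∣ a * b - c * d ∣ ≤ ε
    *-close a b c d {C} {ε} 0<C ∣a∣≤C ∣d∣≤C a≈c b≈d = begin
      ∣ a * b - c * d ∣                      ≡⟨ cong ∣_∣ (solve 4 (λ a b c d →
                                                  a :* b :- c :* d := a :* (b :- d) :+ d :* (a :- c))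
                                                  refl a b c d) ⟩
      ∣ a * (b - d) + d * (a - c) ∣          ≤⟨ ∣p+q∣≤∣p∣+∣q∣ (a * (b - d)) (d * (a - c)) ⟩
      ∣ a * (b - d) ∣ + ∣ d * (a - c) ∣      ≡⟨ cong₂ _+_ (∣p*q∣≡∣p∣*∣q∣ a (b - d)) (∣p*q∣≡∣p∣*∣q∣ d (a - c)) ⟩
      ∣ a ∣ * ∣ b - d ∣ + ∣ d ∣ * ∣ a - c ∣  ≤⟨ +-mono-≤
                                                  (*-mono-nonNeg (0≤∣p∣ (b - d)) (<⇒≤ 0<C) ∣a∣≤C b≈d)
                                                  (*-mono-nonNeg (0≤∣p∣ (a - c)) (<⇒≤ 0<C) ∣d∣≤C a≈c) ⟩
      C * (½ * (ε * i)) + C * (½ * (ε * i))  ≡⟨ solve 4 (λ c h e i →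
                                                  c :* (h :* (e :* i)) :+ c :* (h :* (e :* i))
                                                  := (h :* e :+ h :* e) :* (c :* i)) refl C ½ ε i ⟩
      (½ * ε + ½ * ε) * (C * i)              ≡⟨ cong₂ _*_ (half+half ε)
                                                  (recip-inverseʳ C (λ C≡0 → <⇒≢ 0<C (sym C≡0))) ⟩
      ε * 1ℚ                                 ≡⟨ *-identityʳ ε ⟩
      ε                                      ∎
      where
      open ≤-Reasoning
      i = recip C

    recip-close : ∀ p q {δ ε} → 0ℚ < δ → 0ℚ < ε → δ ≤ p → δ ≤ q →
                  ∣ q - p ∣ ≤ ε * (δ * δ) → ∣ recip p - recip q ∣ ≤ ε
    recip-close p q {δ} {ε} 0<δ 0<ε δ≤p δ≤q p≈q = begin
      ∣ u - v ∣                    ≡⟨ cong ∣_∣ (cong₂ _-_ (sym (*-identityʳ u)) (sym (*-identityʳ v))) ⟩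
      ∣ u * 1ℚ - v * 1ℚ ∣          ≡⟨ cong₂ (λ s t → ∣ u * s - v * t ∣)
                                        (sym (inverse 0<q)) (sym (inverse 0<p)) ⟩
      ∣ u * (q * v) - v * (p * u) ∣  ≡⟨ cong ∣_∣ (solve 4 (λ u v p q →
                                        u :* (q :* v) :- v :* (p :* u) := (u :* v) :* (q :- p))
                                        refl u v p q) ⟩
      ∣ (u * v) * (q - p) ∣        ≡⟨ ∣p*q∣≡∣p∣*∣q∣ (u * v) (q - p) ⟩
      ∣ u * v ∣ * ∣ q - p ∣        ≡⟨ cong (_* ∣ q - p ∣) (0≤p⇒∣p∣≡p 0≤uv) ⟩
      (u * v) * ∣ q - p ∣          ≤⟨ *-monoˡ-≤-nonNeg (u * v) {{nonNegative 0≤uv}} p≈q ⟩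
      (u * v) * (ε * (δ * δ))      ≡⟨ solve 4 (λ u v e d →
                                        (u :* v) :* (e :* (d :* d)) := e :* ((d :* u) :* (d :* v)))
                                        refl u v ε δ ⟩
      ε * ((δ * u) * (δ * v))      ≤⟨ *-monoˡ-≤-nonNeg ε {{<⇒nonNeg 0<ε}}
                                        (*-mono-nonNeg (<⇒≤ (*-pos 0<δ (recip-pos 0<q))) (<⇒≤ 0<1)
                                          (δr≤1 δ≤p 0<p) (δr≤1 δ≤q 0<q)) ⟩
      ε * 1ℚ                       ≡⟨ *-identityʳ ε ⟩
      ε                            ∎
      where
      open ≤-Reasoning
      u = recip p
      v = recip q
      0<p = <-≤-trans 0<δ δ≤p
      0<q = <-≤-trans 0<δ δ≤q
      0≤uv = <⇒≤ (*-pos (recip-pos 0<p) (recip-pos 0<q))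
      inverse : ∀ {r} → 0ℚ < r → r * recip r ≡ 1ℚ
      inverse {r} 0<r = recip-inverseʳ r (λ r≡0 → <⇒≢ 0<r (sym r≡0))
      δr≤1 : ∀ {r} → δ ≤ r → 0ℚ < r → δ * recip r ≤ 1ℚ
      δr≤1 {r} δ≤r 0<r = ≤-trans
        (*-monoʳ-≤-nonNeg (recip r) {{<⇒nonNeg (recip-pos 0<r)}} δ≤r)
        (≤-reflexive (inverse 0<r))

  IsCauchy : (ℕ → ℚ) → Set
  IsCauchy s = ∀ ε → 0ℚ < ε →
    ∃ λ N → ∀ m n → N ℕ.≤ m → N ℕ.≤ n → ∣ s m - s n ∣ ≤ ε

  record ℝ : Set where
    field
      approx : ℕ → ℚ
      cauchy : IsCauchy approx

  open ℝ public

  infix 4 _≤ℝ_ _<ℝ_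

  _≤ℝ_ : ℝ → ℝ → Set
  x ≤ℝ y = ∀ ε → 0ℚ < ε → ∃ λ N → ∀ n → N ℕ.≤ n → approx x n ≤ approx y n + ε

  _<ℝ_ : ℝ → ℝ → Set
  x <ℝ y = ∃ λ δ → 0ℚ < δ ×
    ∃ λ N → ∀ n → N ℕ.≤ n → approx x n + δ ≤ approx y n

  fromℚ : ℚ → ℝ
  fromℚ q .approx _ = q
  fromℚ q .cauchy ε 0<ε = 0 , λ _ _ _ _ →
    subst (λ p → ∣ p ∣ ≤ ε) (sym (+-inverseʳ q)) (<⇒≤ 0<ε)

  fromℕ : ℕ → ℝ
  fromℕ n = fromℚ (+ n / 1)

  0ℝ 1ℝ : ℝ
  0ℝ = fromℚ 0ℚ
  1ℝ = fromℚ 1ℚ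

  infixl 6 _-ℝ_
  infixl 7 _*ℝ_ _÷ℝ_[_]
  infixr 8 _^ℝ_

  _-ℝ_ : ℝ → ℝ → ℝ
  (x -ℝ y) .approx n = approx x n - approx y n
  (x -ℝ y) .cauchy ε 0<ε
    with M , hx ← cauchy x (½ * ε) (half 0<ε)
       | N , hy ← cauchy y (½ * ε) (half 0<ε) = M ℕ.⊔ N , λ m n M⊔N≤m M⊔N≤n →
    let xm = approx x m; xn = approx x n; ym = approx y m; yn = approx y n
        open ≤-Reasoning in begin
    ∣ (xm - ym) - (xn - yn) ∣     ≡⟨ cong ∣_∣ (solve 4 (λ a b c d →
                                       (a :- b) :- (c :- d) := (a :- c) :- (b :- d))
                                       refl xm ym xn yn) ⟩
    ∣ (xm - xn) - (ym - yn) ∣     ≤⟨ ∣p-q∣≤∣p∣+∣q∣ (xm - xn) (ym - yn) ⟩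
    ∣ xm - xn ∣ + ∣ ym - yn ∣     ≤⟨ +-mono-≤
                                       (hx m n (ℕ.m⊔n≤o⇒m≤o M N M⊔N≤m) (ℕ.m⊔n≤o⇒m≤o M N M⊔N≤n))
                                       (hy m n (ℕ.m⊔n≤o⇒n≤o M N M⊔N≤m) (ℕ.m⊔n≤o⇒n≤o M N M⊔N≤n)) ⟩
    ½ * ε + ½ * ε                 ≡⟨ half+half ε ⟩
    ε                             ∎

  ∣_∣ℝ : ℝ → ℝ
  ∣ x ∣ℝ .approx n = ∣ approx x n ∣
  ∣ x ∣ℝ .cauchy ε 0<ε with N , h ← cauchy x ε 0<ε = N , λ m n N≤m N≤n →
    let xm = approx x m; xn = approx x n in
    ∣∣≤ (≤-trans (∣∣-nearby xm xn) (h m n N≤m N≤n))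
        (subst (_≤ ε)
          (solve 2 (λ p q → q :- p := :- (p :- q)) refl ∣ xm ∣ ∣ xn ∣)
          (≤-trans (∣∣-nearby xn xm) (h n m N≤n N≤m)))

  bounded : ∀ (x : ℝ) → ∃ λ B → 0ℚ < B × ∃ λ N → ∀ n → N ℕ.≤ n → ∣ approx x n ∣ ≤ B
  bounded x with N , h ← cauchy x 1ℚ 0<1 =
    1ℚ + ∣ approx x N ∣ , +-mono-<-≤ 0<1 (0≤∣p∣ (approx x N)) , N , λ n N≤n →
    ≤-from-- (≤-trans (∣∣-nearby (approx x n) (approx x N)) (h n N N≤n ℕ.≤-refl))

  _*ℝ_ : ℝ → ℝ → ℝ
  (x *ℝ y) .approx n = approx x n * approx y n
  (x *ℝ y) .cauchy ε 0<ε = N , close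
    where
    A = proj₁ (bounded x)
    B = proj₁ (bounded y)
    0<A = proj₁ (proj₂ (bounded x))
    0<B = proj₁ (proj₂ (bounded y))

    C : ℚ
    C = A + B

    0<C : 0ℚ < C
    0<C = +-mono-< 0<A 0<B

    A≤C : A ≤ C
    A≤C = subst (_≤ C) (+-identityʳ A) (+-monoʳ-≤ A (<⇒≤ 0<B))

    B≤C : B ≤ C
    B≤C = subst (_≤ C) (+-identityˡ B) (+-monoˡ-≤ B (<⇒≤ 0<A))

    δ : ℚ
    δ = ½ * (ε * recip C)

    0<δ : 0ℚ < δ
    0<δ = half (*-pos 0<ε (recip-pos 0<C))

    N₁ = proj₁ (proj₂ (proj₂ (bounded x)))
    N₂ = proj₁ (proj₂ (proj₂ (bounded y)))
    N₃ = proj₁ (cauchy x δ 0<δ)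
    N₄ = proj₁ (cauchy y δ 0<δ)
    N = (N₁ ℕ.⊔ N₂) ℕ.⊔ (N₃ ℕ.⊔ N₄)

    close : ∀ m n → N ℕ.≤ m → N ℕ.≤ n →
            ∣ approx x m * approx y m - approx x n * approx y n ∣ ≤ ε
    close m n N≤m N≤n = *-close (approx x m) (approx y m) (approx x n) (approx y n) 0<C
      (≤-trans (proj₂ (proj₂ (proj₂ (bounded x))) m (ℕ.m⊔n≤o⇒m≤o N₁ N₂ (low N≤m))) A≤C)
      (≤-trans (proj₂ (proj₂ (proj₂ (bounded y))) n (ℕ.m⊔n≤o⇒n≤o N₁ N₂ (low N≤n))) B≤C)
      (proj₂ (cauchy x δ 0<δ) m n (ℕ.m⊔n≤o⇒m≤o N₃ N₄ (high N≤m)) (ℕ.m⊔n≤o⇒m≤o N₃ N₄ (high N≤n)))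
      (proj₂ (cauchy y δ 0<δ) m n (ℕ.m⊔n≤o⇒n≤o N₃ N₄ (high N≤m)) (ℕ.m⊔n≤o⇒n≤o N₃ N₄ (high N≤n)))
      where
      low : ∀ {o} → N ℕ.≤ o → N₁ ℕ.⊔ N₂ ℕ.≤ o
      low = ℕ.m⊔n≤o⇒m≤o (N₁ ℕ.⊔ N₂) (N₃ ℕ.⊔ N₄)
      high : ∀ {o} → N ℕ.≤ o → N₃ ℕ.⊔ N₄ ℕ.≤ o
      high = ℕ.m⊔n≤o⇒n≤o (N₁ ℕ.⊔ N₂) (N₃ ℕ.⊔ N₄)

  _^ℝ_ : ℝ → ℕ → ℝ
  x ^ℝ zero  = 1ℝ
  x ^ℝ suc n = x *ℝ x ^ℝ n

  invℝ : (x : ℝ) → 0ℝ <ℝ x → ℝ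
  invℝ x _ .approx n = recip (approx x n)
  invℝ x (δ , 0<δ , N , h) .cauchy ε 0<ε
    with M , x-close ← cauchy x (ε * (δ * δ)) (*-pos 0<ε (*-pos 0<δ 0<δ)) =
    N ℕ.⊔ M , λ m n N⊔M≤m N⊔M≤n →
    recip-close (approx x m) (approx x n) 0<δ 0<ε (δ≤x (ℕ.m⊔n≤o⇒m≤o N M N⊔M≤m)) (δ≤x (ℕ.m⊔n≤o⇒m≤o N M N⊔M≤n))
      (x-close n m (ℕ.m⊔n≤o⇒n≤o N M N⊔M≤n) (ℕ.m⊔n≤o⇒n≤o N M N⊔M≤m))
    where
    δ≤x : ∀ {n} → N ℕ.≤ n → δ ≤ approx x n
    δ≤x {n} N≤n = subst (_≤ approx x n) (+-identityˡ δ) (h n N≤n)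

  _÷ℝ_[_] : (x y : ℝ) → 0ℝ <ℝ y → ℝ
  x ÷ℝ y [ 0<y ] = x *ℝ invℝ y 0<y

  *ℝ-pos : ∀ x y → 0ℝ <ℝ x → 0ℝ <ℝ y → 0ℝ <ℝ x *ℝ y
  *ℝ-pos x y (δ , 0<δ , M , hx) (η , 0<η , N , hy) =
    δ * η , *-pos 0<δ 0<η , M ℕ.⊔ N , λ n M⊔N≤n →
    let δ≤x = subst (_≤ approx x n) (+-identityˡ δ) (hx n (ℕ.m⊔n≤o⇒m≤o M N M⊔N≤n))
        η≤y = subst (_≤ approx y n) (+-identityˡ η) (hy n (ℕ.m⊔n≤o⇒n≤o M N M⊔N≤n))
    in subst (_≤ approx x n * approx y n) (sym (+-identityˡ (δ * η)))
         (*-mono-nonNeg (<⇒≤ 0<η) (≤-trans (<⇒≤ 0<δ) δ≤x) δ≤x η≤y)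

  ^ℝ-pos : ∀ x → 0ℝ <ℝ x → ∀ n → 0ℝ <ℝ x ^ℝ n
  ^ℝ-pos x 0<x zero    = 1ℚ , 0<1 , 0 , λ _ _ → ≤-refl
  ^ℝ-pos x 0<x (suc n) = *ℝ-pos x (x ^ℝ n) 0<x (^ℝ-pos x 0<x n)

  ----------------------------------------------------------------------
  -- The natural logarithm

  harmonic : ℕ → ℚ
  harmonic zero    = 0ℚ
  harmonic (suc n) = harmonic n + + 1 / suc n

  -- With step 1/N, the right-endpoint Riemann sum of  ∫₁ˣ dt/t  is
  -- Σ_{N<i≤xN} (1/N)·1/(i/N) = Σ_{N<i≤xN} 1/i.

  riemannSum : ℕ → ℕ → ℚ
  riemannSum x N = harmonic (x ℕ.* N) - harmonic N

  private
    ι : ℕ → ℚ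
    ι n = + n / 1

    ι-suc : ∀ n → ι (suc n) ≡ 1ℚ + ι n
    ι-suc n = /1-+ 1ℤ (+ n)

    0≤1/ : ∀ n → 0ℚ ≤ + 1 / suc n
    0≤1/ n = nonNegative⁻¹ _ {{normalize-nonNeg 1 (suc n)}}

    1/-antimono : ∀ {m n} → m ℕ.≤ n → + 1 / suc n ≤ + 1 / suc m
    1/-antimono {m} {n} m≤n = toℚᵘ-cancel-≤
      (ℚᵘ.≤-respʳ-≃ (ℚᵘ.≃-sym (toℚᵘ-/ 1ℤ m)) (ℚᵘ.≤-respˡ-≃ (ℚᵘ.≃-sym (toℚᵘ-/ 1ℤ n))
        (ℚᵘ.*≤* (ℤ.+≤+ (ℕ.+-monoˡ-≤ 0 (ℕ.s≤s m≤n))))))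

    -- B · 1/(nB) = 1/n, with n and B shifted by one
    block : ∀ n B → ι (suc B) * (+ 1 / (suc n ℕ.* suc B)) ≡ + 1 / suc n
    block n B = toℚᵘ-injective
      (ℚᵘ.≃-trans (toℚᵘ-homo-* (ι (suc B)) (+ 1 / (suc n ℕ.* suc B)))
      (ℚᵘ.≃-trans (ℚᵘ.*-cong (toℚᵘ-/ (+ suc B) 0) (toℚᵘ-/ 1ℤ (B ℕ.+ n ℕ.* suc B)))
      (ℚᵘ.≃-trans (*≡* eq) (ℚᵘ.≃-sym (toℚᵘ-/ 1ℤ n)))))
      where
      eq : (+ suc B ℤ.* 1ℤ) ℤ.* + suc n ≡ 1ℤ ℤ.* + (1 ℕ.* (suc n ℕ.* suc B))
      eq = cong +_ (begin
        suc B ℕ.* 1 ℕ.* suc n         ≡⟨ cong (ℕ._* suc n) (ℕ.*-identityʳ (suc B)) ⟩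
        suc B ℕ.* suc n               ≡⟨ ℕ.*-comm (suc B) (suc n) ⟩
        suc n ℕ.* suc B               ≡⟨ ℕ.*-identityˡ _ ⟨
        1 ℕ.* (suc n ℕ.* suc B)       ≡⟨ ℕ.*-identityˡ _ ⟨
        1 ℕ.* (1 ℕ.* (suc n ℕ.* suc B)) ∎)
        where open ≡-Reasoning

  harmonic-+-≥ : ∀ a b {c} → b ℕ.+ a ℕ.≤ suc c →
                 harmonic a + ι b * (+ 1 / suc c) ≤ harmonic (b ℕ.+ a)
  harmonic-+-≥ a zero {c} _ = ≤-reflexive
    (trans (cong (λ q → harmonic a + q) (*-zeroˡ (+ 1 / suc c))) (+-identityʳ _))
  harmonic-+-≥ a (suc b) {c} h = begin
    harmonic a + ι (suc b) * r    ≡⟨ cong (λ q → harmonic a + q * r) (ι-suc b) ⟩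
    harmonic a + (1ℚ + ι b) * r   ≡⟨ solve 3 (λ H i r → H :+ (con 1ℤ :+ i) :* r
                                       := (H :+ i :* r) :+ r) refl (harmonic a) (ι b) r ⟩
    (harmonic a + ι b * r) + r    ≤⟨ +-mono-≤ (harmonic-+-≥ a b (ℕ.≤-trans (ℕ.n≤1+n _) h))
                                       (1/-antimono (ℕ.s≤s⁻¹ h)) ⟩
    harmonic (suc b ℕ.+ a)        ∎
    where
    open ≤-Reasoning
    r = + 1 / suc c

  harmonic-+-≤ : ∀ a b {c} → c ℕ.≤ a →
                 harmonic (b ℕ.+ a) ≤ harmonic a + ι b * (+ 1 / suc c)
  harmonic-+-≤ a zero {c} _ = ≤-reflexive (sym
    (trans (cong (λ q → harmonic a + q) (*-zeroˡ (+ 1 / suc c))) (+-identityʳ _)))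
  harmonic-+-≤ a (suc b) {c} h = begin
    harmonic (suc b ℕ.+ a)        ≤⟨ +-mono-≤ (harmonic-+-≤ a b h)
                                       (1/-antimono (ℕ.≤-trans h (ℕ.m≤n+m a b))) ⟩
    (harmonic a + ι b * r) + r    ≡⟨ solve 3 (λ H i r → H :+ (con 1ℤ :+ i) :* r
                                       := (H :+ i :* r) :+ r) refl (harmonic a) (ι b) r ⟨
    harmonic a + (1ℚ + ι b) * r   ≡⟨ cong (λ q → harmonic a + q * r) (ι-suc b) ⟨
    harmonic a + ι (suc b) * r    ∎
    where
    open ≤-Reasoning
    r = + 1 / suc c

  harmonic-mono : ∀ a b → harmonic a ≤ harmonic (b ℕ.+ a)
  harmonic-mono a zero    = ≤-refl
  harmonic-mono a (suc b) = ≤-trans (harmonic-mono a b)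
    (subst (_≤ harmonic (suc b ℕ.+ a)) (+-identityʳ (harmonic (b ℕ.+ a)))
      (+-monoʳ-≤ (harmonic (b ℕ.+ a)) (0≤1/ (b ℕ.+ a))))

  private
    module Refine (B : ℕ) where

      D : ℕ → ℚ
      D n = harmonic (n ℕ.* suc B) - harmonic n

      D-step : ∀ n → D n ≤ D (suc n)
      D-step n = subst₂ _≤_
        (solve 3 (λ H h r → (H :+ r) :- (h :+ r) := H :- h) refl
          (harmonic (n ℕ.* suc B)) (harmonic n) (+ 1 / suc n))
        refl
        (+-monoˡ-≤ (- harmonic (suc n))
          (subst (λ q → harmonic (n ℕ.* suc B) + q ≤ harmonic (suc n ℕ.* suc B)) (block n B)
            (harmonic-+-≥ (n ℕ.* suc B) (suc B) ℕ.≤-refl)))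

      D-mono : ∀ n d → D n ≤ D (d ℕ.+ n)
      D-mono n zero    = ≤-refl
      D-mono n (suc d) = ≤-trans (D-mono n d) (D-step (d ℕ.+ n))

      E : ℕ → ℚ
      E n = D (suc n) + + 1 / suc n

      D≤E : ∀ n → D (suc n) ≤ E n
      D≤E n = subst (_≤ E n) (+-identityʳ (D (suc n))) (+-monoʳ-≤ (D (suc n)) (0≤1/ n))

      E-step : ∀ n → E (suc n) ≤ E n
      E-step n = subst₂ _≤_
        (solve 3 (λ H h r → H :- h := (H :- (h :+ r)) :+ r) refl
          (harmonic (suc (suc n) ℕ.* suc B)) (harmonic (suc n)) (+ 1 / suc (suc n)))
        (solve 3 (λ H h r → (H :+ r) :- h := (H :- h) :+ r) refl
          (harmonic (suc n ℕ.* suc B)) (harmonic (suc n)) (+ 1 / suc n))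
        (+-monoˡ-≤ (- harmonic (suc n))
          (subst (λ q → harmonic (suc (suc n) ℕ.* suc B) ≤ harmonic (suc n ℕ.* suc B) + q)
            (block n B)
            (harmonic-+-≤ (suc n ℕ.* suc B) (suc B) (ℕ.n≤1+n _))))

      E-anti : ∀ n d → E (d ℕ.+ n) ≤ E n
      E-anti n zero    = ≤-refl
      E-anti n (suc d) = ≤-trans (E-step (d ℕ.+ n)) (E-anti n d)

    exchange : ∀ p q r s → (p - q) - (r - s) ≡ (p - r) - (q - s)
    exchange = solve 4 (λ p q r s → (p :- q) :- (r :- s) := (p :- r) :- (q :- s)) refl

    -- Refining the partition increases the sum, by less than one step.
    refine-≥ : ∀ x .{{_ : NonZero x}} A B →
               riemannSum x (suc A) ≤ riemannSum x (suc A ℕ.* suc B)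
    refine-≥ x@(suc y) A B = begin
      H xa - H a               ≡⟨ solve 3 (λ p q r → p :- q := (p :- r) :+ (r :- q)) refl (H xa) (H a) (H ab) ⟩
      (H xa - H ab) + (H ab - H a)
        ≤⟨ +-monoʳ-≤ (H xa - H ab) mono ⟩
      (H xa - H ab) + (H (xa ℕ.* suc B) - H xa)
        ≡⟨ solve 3 (λ p r s → (p :- r) :+ (s :- p) := s :- r) refl (H xa) (H ab) (H (xa ℕ.* suc B)) ⟩
      H (xa ℕ.* suc B) - H ab  ≡⟨ cong (λ k → H k - H ab) (ℕ.*-assoc x a (suc B)) ⟩
      H (x ℕ.* ab) - H ab      ∎
      where
      open ≤-Reasoning
      H = harmonic
      a = suc A
      xa = x ℕ.* a
      ab = a ℕ.* suc B
      mono : H ab - H a ≤ H (xa ℕ.* suc B) - H xa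
      mono = subst (λ k → H ab - H a ≤ Refine.D B k) (ℕ.+-comm (y ℕ.* a) a)
               (Refine.D-mono B a (y ℕ.* a))

    refine-≤ : ∀ x .{{_ : NonZero x}} A B →
               riemannSum x (suc A ℕ.* suc B) ≤ riemannSum x (suc A) + + 1 / suc A
    refine-≤ x@(suc y) A B = begin
      H (x ℕ.* ab) - H ab      ≡⟨ cong (λ k → H k - H ab) (ℕ.*-assoc x a (suc B)) ⟨
      H (xa ℕ.* suc B) - H ab  ≡⟨ solve 3 (λ p r s → s :- r := (s :- p) :+ (p :- r)) refl (H xa) (H ab) (H (xa ℕ.* suc B)) ⟩
      (H (xa ℕ.* suc B) - H xa) + (H xa - H ab)
        ≤⟨ +-monoˡ-≤ (H xa - H ab) anti ⟩
      ((H ab - H a) + + 1 / a) + (H xa - H ab)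
        ≡⟨ solve 4 (λ p q r t → ((r :- q) :+ t) :+ (p :- r) := (p :- q) :+ t) refl
             (H xa) (H a) (H ab) (+ 1 / a) ⟩
      (H xa - H a) + + 1 / a   ∎
      where
      open ≤-Reasoning
      H = harmonic
      a = suc A
      xa = x ℕ.* a
      ab = a ℕ.* suc B
      shift : suc (y ℕ.* a ℕ.+ A) ≡ xa
      shift = cong suc (ℕ.+-comm (y ℕ.* a) A)
      anti : H (xa ℕ.* suc B) - H xa ≤ (H ab - H a) + + 1 / a
      anti = subst (λ k → Refine.D B k ≤ Refine.E B A) shift
        (≤-trans (Refine.D≤E B (y ℕ.* a ℕ.+ A)) (Refine.E-anti B A (y ℕ.* a)))

    riemannSum-close : ∀ x .{{_ : NonZero x}} A B →
      riemannSum x (suc A) ≤ riemannSum x (suc B) + + 1 / suc B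
    riemannSum-close x A B = ≤-trans (refine-≥ x A B)
      (subst (λ k → riemannSum x k ≤ riemannSum x (suc B) + + 1 / suc B)
        (ℕ.*-comm (suc B) (suc A)) (refine-≤ x B A))

    archimedean : ∀ {ε} → 0ℚ < ε → ∃ λ N → + 1 / suc N ≤ ε
    archimedean {mkℚ (+ suc n) d _} _ = d , toℚᵘ-cancel-≤
      (ℚᵘ.≤-respˡ-≃ (ℚᵘ.≃-sym (toℚᵘ-/ 1ℤ d))
        (ℚᵘ.*≤* (ℤ.+≤+ (ℕ.*-monoˡ-≤ (suc d) (ℕ.s≤s (ℕ.z≤n {n}))))))
    archimedean {mkℚ (+ zero) _ _} (*<* (ℤ.+<+ ()))
    archimedean {mkℚ -[1+ _ ] _ _} (*<* ())

  log : (x : ℕ) → .{{_ : NonZero x}} → ℝ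
  log x .approx n = riemannSum x (suc n)
  log x .cauchy ε 0<ε with N , 1/N≤ε ← archimedean 0<ε = N , λ m n N≤m N≤n →
    let Lm = riemannSum x (suc m); Ln = riemannSum x (suc n) in
    ∣∣≤ (-‿mono (≤-trans (riemannSum-close x m n)
          (+-monoʳ-≤ Ln (≤-trans (1/-antimono N≤n) 1/N≤ε))))
        (subst (_≤ ε) (solve 2 (λ p q → q :- p := :- (p :- q)) refl Lm Ln)
          (-‿mono (≤-trans (riemannSum-close x n m)
            (+-monoʳ-≤ Lm (≤-trans (1/-antimono N≤m) 1/N≤ε)))))

  log-pos : ∀ x .{{_ : NonTrivial x}} → 0ℝ <ℝ log x {{ℕ.nonTrivial⇒nonZero x}}
  log-pos x@(suc (suc y)) = ½ , positive⁻¹ ½ , 0 , λ n _ → bound (suc n)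
    where
    open ≤-Reasoning
    bound : ∀ N .{{_ : NonZero N}} → 0ℚ + ½ ≤ riemannSum x N
    bound N@(suc n) = begin
      0ℚ + ½                                    ≡⟨ +-identityˡ ½ ⟩
      + 1 / 2                                   ≡⟨ block 1 n ⟨
      ι N * (+ 1 / (2 ℕ.* N))                   ≡⟨ solve 2 (λ h t → t := (h :+ t) :- h) refl
                                                     (harmonic N) (ι N * (+ 1 / (2 ℕ.* N))) ⟩
      (harmonic N + ι N * (+ 1 / (2 ℕ.* N))) - harmonic N
        ≤⟨ +-monoˡ-≤ (- harmonic N) (≤-trans
             (harmonic-+-≥ N N (ℕ.≤-reflexive (cong (N ℕ.+_) (sym (ℕ.+-identityʳ N)))))
             (harmonic-mono (N ℕ.+ N) (y ℕ.* N))) ⟩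
      harmonic (y ℕ.* N ℕ.+ (N ℕ.+ N)) - harmonic N
        ≡⟨ cong (λ k → harmonic k - harmonic N)
             (trans (ℕ.+-comm (y ℕ.* N) (N ℕ.+ N)) (ℕ.+-assoc N N (y ℕ.* N))) ⟩
      riemannSum x N                            ∎

  ----------------------------------------------------------------------
  -- Asymptotic equivalence as x → ∞ through the integers x ≥ 2 (where
  -- log x > 0, so that one may divide by it):  f - g = o(g).

  infix 4 _∼_

  _∼_ : (f g : (x : ℕ) → .{{NonTrivial x}} → ℝ) → Set
  f ∼ g = ∀ ε → 0ℚ < ε → ∃ λ X → ∀ x .{{_ : NonTrivial x}} → X ℕ.≤ x →
    ∣ f x -ℝ g x ∣ℝ ≤ℝ fromℚ ε *ℝ ∣ g x ∣ℝ

open Real using (ℝ; 0ℝ; fromℕ; _<ℝ_; _*ℝ_; _^ℝ_; _÷ℝ_[_]; log; log-pos; ^ℝ-pos; _∼_)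

------------------------------------------------------------------------
-- The prime k-tuples conjecture

Primeℤ⁺ : ℤ → Set
Primeℤ⁺ (+ n)    = Prime n
Primeℤ⁺ -[1+ _ ] = ⊥

primeℤ⁺? : ∀ z → Dec (Primeℤ⁺ z)
primeℤ⁺? (+ n)    = prime? n
primeℤ⁺? -[1+ _ ] = no λ ()

module _ {k : ℕ} (a : Fin k → ℕ) (b : Fin k → ℤ) where

  form : Fin k → ℕ → ℤ
  form i m = + (a i ℕ.* m) ℤ.+ b i

  formProduct : ℕ → ℤ
  formProduct m = foldr ℤ._*_ 1ℤ (λ i → form i m)

  AllPrime : ℕ → Set
  AllPrime m = ∀ i → Primeℤ⁺ (form i m)

  allPrime? : ∀ m → Dec (AllPrime m)
  allPrime? m = all? (λ i → primeℤ⁺? (form i m))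

  primeTupleCount : ℕ → ℕ
  primeTupleCount x = length (filter allPrime? (applyUpTo suc x))

mainTerm : ℝ → ℕ → (x : ℕ) → .{{NonTrivial x}} → ℝ
mainTerm c k x = (c *ℝ fromℕ x) ÷ℝ logx ^ℝ k [ ^ℝ-pos logx (log-pos x) k ]
  where logx = log x {{ℕ.nonTrivial⇒nonZero x}}

-- The linear forms are required to be pairwise distinct, as the conjecture
-- tacitly intends: with a form repeated the asymptotic formula is false
-- (m+1, m+1 are simultaneously prime with frequency 1/log x, not 1/log² x).

PrimeKTuplesConjecture : Set
PrimeKTuplesConjecture =
  ∀ (k : ℕ) → .{{NonZero k}} →
  (a : Fin k → ℕ) → (∀ i → 0 ℕ.< a i) →
  (b : Fin k → ℤ) → (∀ i → b i ≢ 0ℤ) →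
  Injective _≡_ _≡_ (λ i → a i , b i) →
  ¬ (∃ λ p → Prime p × (∀ m → 1 ℕ.≤ m → + p ℤ.∣ formProduct a b m)) →
  ∃ λ c → 0ℝ <ℝ c × (λ x → fromℕ (primeTupleCount a b x)) ∼ mainTerm c k

------------------------------------------------------------------------
-- Lucas-Carmichael integers

SquareFree : ℕ → Set
SquareFree n = ∀ d → d ℕ.* d ∣ n → d ≡ 1

-- 0 is not Composite, so positivity needs no separate field.
record LucasCarmichael (n : ℕ) : Set where
  field
    composite  : Composite n
    squareFree : SquareFree n
    p+1∣n+1    : ∀ p → Prime p → p ∣ n → p ℕ.+ 1 ∣ n ℕ.+ 1

digitSum : (b : ℕ) → {True (2 ℕ.≤? b)} → ℕ → ℕ
digitSum b {2≤b} N = sum (map toℕ (proj₁ (toDigits b {2≤b} N)))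

primeDivisors : ℕ → List ℕ
primeDivisors n = filter (λ p → prime? p ×-dec p ∣? n) (upTo (suc n))

-- For Lucas-Carmichael n the natural-number division is exact: modulo p+1,
-- the base-(p+2) digit sum of n+2 is congruent to n+2, hence to 1.
degree : ℕ → ℕ
degree n = max 0 (map (λ p → (digitSum (2 ℕ.+ p) (n ℕ.+ 2) ℕ.∸ 1) ℕ./ (1 ℕ.+ p)) (primeDivisors n))

{-# OPTIONS --safe #-}
module Submission where

-- Put aᵢ = 62208·(3, 4, 6, 8, 9, 18, 24), pᵢ = aᵢ t − 1 and n = p₁ ⋯ p₇. In base pᵢ + 2 = aᵢ t + 1
-- the digits of n + 2 are linear functions of t, given by a finite table, and their sum is
-- 1 + αᵢ (pᵢ + 1) with α = (4, 4, 3, 2, 4, 4, 3). Hence n has degree 4 as soon as all pᵢ are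
-- prime; and since the base is 1 modulo pᵢ + 1, the digit sum is congruent to n + 2, so that
-- pᵢ + 1 divides n + 1. No prime p divides ∏ (aᵢ m − 1) at m = p, so the conjecture applies, and
-- c x / log⁷ x is unbounded along x = 2^j because log 2^j ≤ j: the pᵢ are simultaneously prime
-- for arbitrarily large t.

open import Defs
open Real
  using (ℝ; 0ℝ; fromℕ; _<ℝ_; _^ℝ_; log; log-pos; ^ℝ-pos; _∼_; approx
        ; recip; recip-inverseʳ; recip-pos; riemannSum; harmonic; harmonic-+-≤)
open import Data.Digit using (Expansion; fromDigits; toDigits)
open import Data.Fin.Base using (Fin; zero; suc; toℕ)
open import Data.Fin.Properties as Fin using (toℕ<n; all?)
open import Data.Integer.Base as ℤ using (ℤ; +_; -[1+_]; 1ℤ; -1ℤ)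
import Data.Integer.Divisibility as ℤ
import Data.Integer.Properties as ℤ
open import Data.List.Base
  using (List; []; _∷_; [_]; _++_; length; map; foldr; filter; applyUpTo; upTo; tabulate)
open import Data.List.Extrema.Nat using (max≈v⁺)
open import Data.List.Membership.Propositional using (_∈_)
open import Data.List.Membership.Propositional.Properties
  using (∈-filter⁺; ∈-filter⁻; ∈-upTo⁺; ∈-map⁺; ∈-tabulate⁺; ∈-tabulate⁻)
open import Data.List.Membership.Propositional.Properties.WithK using (unique∧set⇒bag)
open import Data.List.Properties
  using (≡-dec; map-tabulate; length-tabulate; filter-++; filter-reject; applyUpTo-∷ʳ
        ; length-filter; length-applyUpTo; length-++)
open import Data.List.Relation.Binary.BagAndSetEquality using (∼bag⇒↭)
open import Data.List.Relation.Binary.Permutation.Propositional using (_↭_)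
open import Data.List.Relation.Binary.Permutation.Propositional.Properties using (↭-length)
open import Data.List.Relation.Binary.Prefix.Heterogeneous using (Prefix; []; _∷_)
open import Data.List.Relation.Binary.Prefix.Heterogeneous.Properties using (prefix?)
open import Data.List.Relation.Unary.All as All using (All; []; _∷_)
import Data.List.Relation.Unary.All.Properties as All
open import Data.List.Relation.Unary.AllPairs using (_∷_)
open import Data.List.Relation.Unary.Any using (here; there)
open import Data.List.Relation.Unary.Unique.Propositional using (Unique)
import Data.List.Relation.Unary.Unique.Propositional.Properties as Unique
open import Data.Nat.Base
open import Data.Nat.Divisibility
open import Data.Nat.DivMod using (m*n/n≡m; [m+kn]%n≡m%n; m<n⇒m%n≡m)
open import Data.Nat.ListAction using (sum; product)
open import Data.Nat.ListAction.Properties using (∈⇒∣product)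
open import Data.Nat.Primality
  using (Prime; prime?; Composite; composite-≢; euclidsLemma; prime⇒nonZero; prime⇒nonTrivial
        ; productOfPrimes≢0; ¬prime[0]; ¬prime[1])
open import Data.Nat.Primality.Factorisation using (factorise; factorisationHasAllPrimeFactors)
open import Data.Nat.Properties
open import Data.Nat.Solver using (module +-*-Solver)
open import Data.Product.Base using (∃; _×_; _,_; proj₁; proj₂)
open import Data.Rational.Base as ℚ using (ℚ; mkℚ; 0ℚ; 1ℚ; ½; *<*; toℚᵘ)
import Data.Rational.Properties as ℚ
open import Data.Rational.Solver using () renaming (module +-*-Solver to ℚ-Solver)
open import Data.Rational.Unnormalised.Base as ℚᵘ using (mkℚᵘ; *≡*)
import Data.Rational.Unnormalised.Properties as ℚᵘ
open import Data.Sum.Base using (inj₁; inj₂)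
open import Data.Vec.Base using (lookup; []; _∷_)
import Data.Vec.Functional as Vector
open import Function.Base using (it)
open import Function.Bundles using (mk⇔)
open import Relation.Binary.PropositionalEquality
  using (_≡_; _≢_; refl; sym; trans; cong; cong₂; subst; subst₂; module ≡-Reasoning)
open import Relation.Nullary using (¬_; Dec; yes; no; contradiction)
open import Relation.Nullary.Decidable using (_×-dec_; _→-dec_; from-yes)
open import Relation.Unary using (Decidable)

open +-*-Solver using (solve; _:=_; _:+_; _:*_; con)
open ℚ-Solver using ()
  renaming (solve to ℚ-solve; _:=_ to _⊜_; _:+_ to _⊞_; _:-_ to _⊟_; _:*_ to _⊠_; :-_ to ⊟_; con to κ)

-- Products of distinct primes and their prime divisors.

primeFactor : ∀ {n} .{{_ : NonZero n}} → n ≢ 1 → ∃ λ p → Prime p × p ∣ n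
primeFactor {n} n≢1 with factorise n
... | record { factors = [] ; isFactorisation = n≡1 } = contradiction n≡1 n≢1
... | record { factors = p ∷ ps ; isFactorisation = n≡Π ; factorsPrime = pr ∷ _ } =
  p , pr , divides (product ps) (trans n≡Π (*-comm p (product ps)))

prime∣prime⇒≡ : ∀ {p q} → Prime p → Prime q → p ∣ q → p ≡ q
prime∣prime⇒≡ {p} {q} pp pq p∣q
  with here p≡q ← factorisationHasAllPrimeFactors pp
         (subst (p ∣_) (sym (*-identityʳ q)) p∣q) (pq ∷ []) = p≡q

-- Induction on `ps`. If q is the head, cancelling one q puts q among the remaining primes, against
-- distinctness; otherwise both factors q pass to the tail.
square∤productOfDistinctPrimes : ∀ {q ps} → Prime q → Unique ps → All Prime ps →
                                 ¬ q * q ∣ product ps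
square∤productOfDistinctPrimes {q} {[]} pq _ _ q²∣1 =
  ¬prime[1] (subst Prime (∣1⇒≡1 (∣-trans (m∣m*n q) q²∣1)) pq)
square∤productOfDistinctPrimes {q} {p ∷ ps} pq (p∉ps ∷ unique) (pp ∷ primes) q²∣pΠ
  with q ∣? p
... | yes q∣p with refl ← prime∣prime⇒≡ pq pp q∣p =
  All.lookup p∉ps (factorisationHasAllPrimeFactors pq
    (*-cancelˡ-∣ q {{prime⇒nonZero pq}} q²∣pΠ) primes) refl
... | no q∤p = square∤productOfDistinctPrimes pq unique primes q²∣Π
  where
  cofactor : ∀ n → q ∣ p * n → q ∣ n
  cofactor n q∣pn with euclidsLemma p n pq q∣pn
  ... | inj₁ q∣p = contradiction q∣p q∤p
  ... | inj₂ q∣n = q∣n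

  q²∣Π : q * q ∣ product ps
  -- Once the product of `ps` is r q, cancelling one q from the hypothesis leaves q dividing p r,
  -- hence r.
  q²∣Π with divides r Π≡rq ← cofactor (product ps) (∣-trans (m∣m*n q) q²∣pΠ) =
    subst (q * q ∣_) (trans (*-comm q r) (sym Π≡rq))
      (*-monoʳ-∣ q (cofactor r (*-cancelˡ-∣ q {{prime⇒nonZero pq}}
        (subst (q * q ∣_) p*Π≡q*pr q²∣pΠ))))
    where
    p*Π≡q*pr : p * product ps ≡ q * (p * r)
    p*Π≡q*pr = trans (cong (p *_) Π≡rq)
      (solve 3 (λ p q r → p :* (r :* q) := q :* (p :* r)) refl p q r)

squareFree-product : ∀ {ps} → Unique ps → All Prime ps → SquareFree (product ps)
squareFree-product {ps} unique primes d d²∣n with d ≟ 1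
... | yes d≡1 = d≡1
... | no  d≢1 = let p , pp , p∣d = primeFactor {{d≢0}} d≢1 in
  contradiction (∣-trans (*-pres-∣ p∣d p∣d) d²∣n) (square∤productOfDistinctPrimes pp unique primes)
  where
  d≢0 : NonZero d
  d≢0 = ≢-nonZero λ { refl → ≢-nonZero⁻¹ (product ps) {{productOfPrimes≢0 primes}} (0∣⇒≡0 d²∣n) }

composite-product : ∀ {p q ps} → All Prime (p ∷ q ∷ ps) → Composite (product (p ∷ q ∷ ps))
composite-product {p} {q} {ps} primes@(pp ∷ pq ∷ _) =
  composite-≢ p {{prime⇒nonTrivial pp}} {{productOfPrimes≢0 primes}} p≢n (m∣m*n _)
  where
  p≢n : p ≢ p * (q * product ps)
  p≢n p≡n = ¬prime[1] (subst Prime (m*n≡1⇒m≡1 q (product ps) qΠ≡1) pq)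
    where
    qΠ≡1 : q * product ps ≡ 1
    qΠ≡1 = *-cancelˡ-≡ _ 1 p {{prime⇒nonZero pp}} (trans (sym p≡n) (sym (*-identityʳ p)))

∈-primeDivisors-product⁻ : ∀ {p ps} → All Prime ps → p ∈ primeDivisors (product ps) → p ∈ ps
∈-primeDivisors-product⁻ {ps = ps} primes p∈
  with pp , p∣n ← proj₂ (∈-filter⁻ (λ p → prime? p ×-dec p ∣? product ps)
         {xs = upTo (suc (product ps))} p∈) = factorisationHasAllPrimeFactors pp p∣n primes

∈-primeDivisors-product⁺ : ∀ {p ps} → All Prime ps → p ∈ ps → p ∈ primeDivisors (product ps)
∈-primeDivisors-product⁺ {ps = ps} primes p∈ps = ∈-filter⁺ (λ p → prime? p ×-dec p ∣? product ps)
  (∈-upTo⁺ (s≤s (∣⇒≤ {{productOfPrimes≢0 primes}} (∈⇒∣product p∈ps))))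
  (All.lookup primes p∈ps , ∈⇒∣product p∈ps)

-- Two duplicate-free lists with the same members are permutations of each other. This is what
-- counts the prime divisors.
primeDivisors-product-↭ : ∀ {ps} → Unique ps → All Prime ps → primeDivisors (product ps) ↭ ps
primeDivisors-product-↭ {ps} unique primes = ∼bag⇒↭ (unique∧set⇒bag
  (Unique.filter⁺ (λ p → prime? p ×-dec p ∣? product ps) (Unique.upTo⁺ (suc (product ps)))) unique
  (mk⇔ (∈-primeDivisors-product⁻ primes) (∈-primeDivisors-product⁺ primes)))

-- Base-b expansions and digit sums.

-- Least significant digit, or constant coefficient, first: the same function values digit lists at
-- a base and polynomials at a point.
horner : ℕ → List ℕ → ℕ
horner b = foldr (λ d v → d + v * b) 0

horner≡0⇒sum≡0 : ∀ b .{{_ : NonZero b}} ds → horner b ds ≡ 0 → sum ds ≡ 0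
horner≡0⇒sum≡0 b []       _  = refl
horner≡0⇒sum≡0 b (d ∷ ds) eq = cong₂ _+_ (m+n≡0⇒m≡0 d eq)
  (horner≡0⇒sum≡0 b ds (m*n≡0⇒m≡0 _ b (m+n≡0⇒n≡0 d eq)))

-- Reduction modulo b equates the lowest digits, and induction treats the rest. The lists themselves
-- may differ by high-order zeros, so only their sums are compared.
sum-digits-unique : ∀ b .{{_ : NonZero b}} ds es → All (_< b) ds → All (_< b) es →
                    horner b ds ≡ horner b es → sum ds ≡ sum es
sum-digits-unique b []         es []  _ eq = sym (horner≡0⇒sum≡0 b es (sym eq))
sum-digits-unique b ds@(_ ∷ _) [] _   _ eq = horner≡0⇒sum≡0 b ds eq
sum-digits-unique b (d ∷ ds) (e ∷ es) (d<b ∷ ds<b) (e<b ∷ es<b) eq =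
  cong₂ _+_ d≡e (sum-digits-unique b ds es ds<b es<b (*-cancelʳ-≡ _ _ b
    (+-cancelˡ-≡ d _ _ (trans eq (cong (_+ horner b es * b) (sym d≡e))))))
  where
  open ≡-Reasoning
  d≡e : d ≡ e
  d≡e = begin
    d                          ≡⟨ m<n⇒m%n≡m d<b ⟨
    d % b                      ≡⟨ [m+kn]%n≡m%n d (horner b ds) b ⟨
    (d + horner b ds * b) % b  ≡⟨ cong (_% b) eq ⟩
    (e + horner b es * b) % b  ≡⟨ [m+kn]%n≡m%n e (horner b es) b ⟩
    e % b                      ≡⟨ m<n⇒m%n≡m e<b ⟩
    e                          ∎

fromDigits≡horner : ∀ {b} (ds : Expansion b) → fromDigits ds ≡ horner b (map toℕ ds)
fromDigits≡horner     []       = refl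
fromDigits≡horner {b} (d ∷ ds) = cong (λ v → toℕ d + v * b) (fromDigits≡horner ds)

digitSum-unique : ∀ b ds → All (_< 2 + b) ds → digitSum (2 + b) (horner (2 + b) ds) ≡ sum ds
digitSum-unique b ds ds<b with es , eq ← toDigits (2 + b) (horner (2 + b) ds) =
  sum-digits-unique (2 + b) (map toℕ es) ds (All.map⁺ (All.universal toℕ<n es)) ds<b
    (trans (sym (fromDigits≡horner es)) eq)

-- Casting out nines: the base 1 + b is 1 modulo b.
horner≡sum+ : ∀ b ds → ∃ λ k → horner (1 + b) ds ≡ sum ds + k * b
horner≡sum+ b []       = 0 , refl
horner≡sum+ b (d ∷ ds) with k , eq ← horner≡sum+ b ds = sum ds + k * (1 + b) , (begin
  d + horner (1 + b) ds * (1 + b)            ≡⟨ cong (λ v → d + v * (1 + b)) eq ⟩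
  d + (sum ds + k * b) * (1 + b)             ≡⟨ solve 4 (λ d s k b →
    d :+ (s :+ k :* b) :* (con 1 :+ b) := (d :+ s) :+ (s :+ k :* (con 1 :+ b)) :* b)
    refl d (sum ds) k b ⟩
  (d + sum ds) + (sum ds + k * (1 + b)) * b  ∎)
  where open ≡-Reasoning

-- The list q may be longer than p, as its further terms can only add to the value.
horner-mono : ∀ x {p q} → Prefix _≤_ p q → horner x p ≤ horner x q
horner-mono x []          = z≤n
horner-mono x (c≤d ∷ p≤q) = +-mono-≤ c≤d (*-monoˡ-≤ x (horner-mono x p≤q))

-- Polynomials with natural coefficients.

-- List equality is decidable and sufficient for equal values at every point. It is not necessary,
-- as trailing zeros are not removed.
Poly : Set
Poly = List ℕ

infixl 6 _⊕_
infixl 7 _⊗_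

_⊕_ : Poly → Poly → Poly
[]      ⊕ q       = q
(c ∷ p) ⊕ []      = c ∷ p
(c ∷ p) ⊕ (d ∷ q) = c + d ∷ p ⊕ q

_⊗_ : Poly → Poly → Poly
[]      ⊗ q = []
(c ∷ p) ⊗ q = map (c *_) q ⊕ (0 ∷ p ⊗ q)

horner-⊕ : ∀ x p q → horner x (p ⊕ q) ≡ horner x p + horner x q
horner-⊕ x []      q       = refl
horner-⊕ x (c ∷ p) []      = sym (+-identityʳ _)
horner-⊕ x (c ∷ p) (d ∷ q) = trans (cong (λ v → c + d + v * x) (horner-⊕ x p q))
  (solve 5 (λ c d u v x → c :+ d :+ (u :+ v) :* x := (c :+ u :* x) :+ (d :+ v :* x))
    refl c d (horner x p) (horner x q) x)

horner-scale : ∀ x c p → horner x (map (c *_) p) ≡ c * horner x p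
horner-scale x c []      = sym (*-zeroʳ c)
horner-scale x c (d ∷ p) = trans (cong (λ v → c * d + v * x) (horner-scale x c p))
  (solve 4 (λ c d v x → c :* d :+ c :* v :* x := c :* (d :+ v :* x)) refl c d (horner x p) x)

horner-⊗ : ∀ x p q → horner x (p ⊗ q) ≡ horner x p * horner x q
horner-⊗ x []      q = refl
horner-⊗ x (c ∷ p) q = begin
  horner x (map (c *_) q ⊕ (0 ∷ p ⊗ q))             ≡⟨ horner-⊕ x (map (c *_) q) (0 ∷ p ⊗ q) ⟩
  horner x (map (c *_) q) + horner x (p ⊗ q) * x    ≡⟨ cong₂ (λ u v → u + v * x)
                                                         (horner-scale x c q) (horner-⊗ x p q) ⟩
  c * horner x q + horner x p * horner x q * x      ≡⟨ solve 4 (λ c p q x →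
    c :* q :+ p :* q :* x := (c :+ p :* x) :* q) refl c (horner x p) (horner x q) x ⟩
  (c + horner x p * x) * horner x q                 ∎
  where open ≡-Reasoning

∏ : List Poly → Poly
∏ = foldr _⊗_ [ 1 ]

∑ : List Poly → Poly
∑ = foldr _⊕_ []

hornerₚ : Poly → List Poly → Poly
hornerₚ b = foldr (λ d v → d ⊕ v ⊗ b) []

horner-∏ : ∀ x ps → horner x (∏ ps) ≡ product (map (horner x) ps)
horner-∏ x []       = refl
horner-∏ x (p ∷ ps) = trans (horner-⊗ x p (∏ ps)) (cong (horner x p *_) (horner-∏ x ps))

horner-∑ : ∀ x ps → horner x (∑ ps) ≡ sum (map (horner x) ps)
horner-∑ x []       = refl
horner-∑ x (p ∷ ps) = trans (horner-⊕ x p (∑ ps)) (cong (λ v → horner x p + v) (horner-∑ x ps))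

-- Evaluation respects sums and products, so it carries an expansion in a polynomial base to a
-- numerical one.
horner-hornerₚ : ∀ x b ds → horner x (hornerₚ b ds) ≡ horner (horner x b) (map (horner x) ds)
horner-hornerₚ x b []       = refl
horner-hornerₚ x b (d ∷ ds) = begin
  horner x (d ⊕ hornerₚ b ds ⊗ b)
    ≡⟨ horner-⊕ x d (hornerₚ b ds ⊗ b) ⟩
  horner x d + horner x (hornerₚ b ds ⊗ b)
    ≡⟨ cong (λ v → horner x d + v) (horner-⊗ x (hornerₚ b ds) b) ⟩
  horner x d + horner x (hornerₚ b ds) * horner x b
    ≡⟨ cong (λ v → horner x d + v * horner x b) (horner-hornerₚ x b ds) ⟩
  horner x d + horner (horner x b) (map (horner x) ds) * horner x b
    ∎
  where open ≡-Reasoning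

-- Digit expansions with polynomial digits.

-- The polynomials ds are the digits of N + 2 in base p + 2, with sum 1 + α (p + 1). The first
-- clause compares coefficients, which bounds a digit by the base at every natural argument.
IsExpansion : (N p : Poly) (α : ℕ) (ds : List Poly) → Set
IsExpansion N p α ds =
  All (λ d → Prefix _≤_ ([ 1 ] ⊕ d) ([ 2 ] ⊕ p)) ds ×
  hornerₚ ([ 2 ] ⊕ p) ds ≡ [ 2 ] ⊕ N ×
  ∑ ds ≡ [ 1 ] ⊕ [ α ] ⊗ ([ 1 ] ⊕ p)

isExpansion? : ∀ N p α ds → Dec (IsExpansion N p α ds)
isExpansion? N p α ds =
  All.all? (λ d → prefix? _≤?_ ([ 1 ] ⊕ d) ([ 2 ] ⊕ p)) ds ×-dec
  ≡-dec _≟_ (hornerₚ ([ 2 ] ⊕ p) ds) ([ 2 ] ⊕ N) ×-dec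
  ≡-dec _≟_ (∑ ds) ([ 1 ] ⊕ [ α ] ⊗ ([ 1 ] ⊕ p))

module _ (N p : Poly) (α : ℕ) (ds : List Poly) (expansion : IsExpansion N p α ds) (x : ℕ) where

  private
    n = horner x N
    q = horner x p
    es = map (horner x) ds

    es<b : All (_< 2 + q) es
    es<b = All.map⁺ (All.map (λ {d} → bound {d}) (proj₁ expansion))
      where
      bound : ∀ {d} → Prefix _≤_ ([ 1 ] ⊕ d) ([ 2 ] ⊕ p) → horner x d < 2 + q
      bound {d} d<b = subst₂ _≤_ (horner-⊕ x [ 1 ] d) (horner-⊕ x [ 2 ] p) (horner-mono x d<b)

    value : horner (2 + q) es ≡ n + 2
    value = begin
      horner (2 + q) es                   ≡⟨ cong (λ b → horner b es) (horner-⊕ x [ 2 ] p) ⟨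
      horner (horner x ([ 2 ] ⊕ p)) es    ≡⟨ horner-hornerₚ x ([ 2 ] ⊕ p) ds ⟨
      horner x (hornerₚ ([ 2 ] ⊕ p) ds)   ≡⟨ cong (horner x) (proj₁ (proj₂ expansion)) ⟩
      horner x ([ 2 ] ⊕ N)                ≡⟨ horner-⊕ x [ 2 ] N ⟩
      2 + n                               ≡⟨ +-comm 2 n ⟩
      n + 2                               ∎
      where open ≡-Reasoning

    sum-es : sum es ≡ 1 + α * (1 + q)
    sum-es = begin
      sum es                                            ≡⟨ horner-∑ x ds ⟨
      horner x (∑ ds)                                   ≡⟨ cong (horner x) (proj₂ (proj₂ expansion)) ⟩
      horner x ([ 1 ] ⊕ [ α ] ⊗ ([ 1 ] ⊕ p))            ≡⟨ horner-⊕ x [ 1 ] ([ α ] ⊗ ([ 1 ] ⊕ p)) ⟩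
      1 + horner x ([ α ] ⊗ ([ 1 ] ⊕ p))                ≡⟨ cong suc (horner-⊗ x [ α ] ([ 1 ] ⊕ p)) ⟩
      1 + horner x [ α ] * horner x ([ 1 ] ⊕ p)         ≡⟨ cong₂ (λ u v → 1 + u * v)
                                                             (+-identityʳ α) (horner-⊕ x [ 1 ] p) ⟩
      1 + α * (1 + q)                                   ∎
      where open ≡-Reasoning

  IsExpansion⇒∣ : q + 1 ∣ n + 1
  IsExpansion⇒∣ with k , eq ← horner≡sum+ (1 + q) es =
    -- The expansion is one of n + 2, so the equation is proved one higher and a successor is
    -- cancelled.
    divides (α + k) (suc-injective (begin
      suc (n + 1)                            ≡⟨ +-suc n 1 ⟨
      n + 2                                  ≡⟨ value ⟨
      horner (2 + q) es                      ≡⟨ eq ⟩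
      sum es + k * (1 + q)                   ≡⟨ cong (_+ k * (1 + q)) sum-es ⟩
      1 + α * (1 + q) + k * (1 + q)          ≡⟨ cong suc (*-distribʳ-+ (1 + q) α k) ⟨
      suc ((α + k) * (1 + q))                ≡⟨ cong (λ r → suc ((α + k) * r)) (+-comm 1 q) ⟩
      suc ((α + k) * (q + 1))                ∎))
    where open ≡-Reasoning

  IsExpansion⇒degree : (digitSum (2 + q) (n + 2) ∸ 1) / (1 + q) ≡ α
  IsExpansion⇒degree = begin
    (digitSum (2 + q) (n + 2) ∸ 1) / (1 + q)  ≡⟨ cong (λ s → (s ∸ 1) / (1 + q)) digits ⟩
    α * (1 + q) / (1 + q)                     ≡⟨ m*n/n≡m α (1 + q) ⟩
    α                                         ∎
    where
    open ≡-Reasoning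
    digits : digitSum (2 + q) (n + 2) ≡ 1 + α * (1 + q)
    digits = trans (cong (λ m → digitSum (2 + q) m) (sym value))
      (trans (digitSum-unique q es es<b) sum-es)

-- Lucas-Carmichael numbers from a table of expansions.

-- `first` is a - 1, the value of a t - 1 at t = 1; `digits` runs from the least significant digit
-- upwards.
record Row : Set where
  constructor row
  field
    first  : ℕ
    α      : ℕ
    digits : List Poly

open Row

-- The prime a t − 1, where a = 1 + k, as a polynomial in s = t − 1; all polynomials are
-- written in s, because in t they have negative coefficients.
prime-poly : ℕ → Poly
prime-poly k = k ∷ suc k ∷ []

candidate : ℕ → ℕ → ℕ
candidate k s = horner s (prime-poly k)

candidate-injective : ∀ s {k l} → candidate k s ≡ candidate l s → k ≡ l
candidate-injective s {k} {l} eq = *-cancelʳ-≡ k l (1 + s) (+-cancelˡ-≡ s _ _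
  (trans (sym (expand k)) (trans eq (expand l))))
  where
  expand : ∀ k → candidate k s ≡ s + k * (1 + s)
  expand k = solve 2 (λ k s → k :+ (con 1 :+ k :+ con 0) :* s := s :+ k :* (con 1 :+ s)) refl k s

-- The table has at least two rows, which makes the product of the primes composite.
module Family {m} (table : Fin (2 + m) → Row)
  (distinct : ∀ i j → first (table i) ≡ first (table j) → i ≡ j) where

  poly : Fin (2 + m) → Poly
  poly i = prime-poly (first (table i))

  N : Poly
  N = ∏ (tabulate poly)

  module _ (expansions : ∀ i → IsExpansion N (poly i) (α (table i)) (digits (table i)))
           (s : ℕ) (primes : ∀ i → Prime (candidate (first (table i)) s)) where

    private
      p : Fin (2 + m) → ℕ
      p i = candidate (first (table i)) s

      ps = tabulate p

      n = product ps

      horner-N : horner s N ≡ n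
      horner-N = trans (horner-∏ s (tabulate poly))
        (cong product (map-tabulate poly (horner s)))

      unique : Unique ps
      unique = Unique.tabulate⁺ {f = p} (λ {i} {j} eq → distinct i j (candidate-injective s eq))

      allPrime : All Prime ps
      allPrime = All.tabulate⁺ primes

      p+1∣n+1 : ∀ i → p i + 1 ∣ n + 1
      p+1∣n+1 i = subst (λ n → p i + 1 ∣ n + 1) horner-N
        (IsExpansion⇒∣ N (poly i) (α (table i)) (digits (table i)) (expansions i) s)

      degreeAt : ℕ → ℕ
      degreeAt q = (digitSum (2 + q) (n + 2) ∸ 1) / (1 + q)

      degreeAt-p : ∀ i → degreeAt (p i) ≡ α (table i)
      degreeAt-p i = subst (λ n → (digitSum (2 + p i) (n + 2) ∸ 1) / (1 + p i) ≡ α (table i)) horner-N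
        (IsExpansion⇒degree N (poly i) (α (table i)) (digits (table i)) (expansions i) s)

    lucasCarmichael : LucasCarmichael n
    lucasCarmichael = record
      { composite  = composite-product allPrime
      ; squareFree = squareFree-product unique allPrime
      ; p+1∣n+1    = λ q pq q∣n → helper (factorisationHasAllPrimeFactors pq q∣n allPrime)
      }
      where
      helper : ∀ {q} → q ∈ ps → q + 1 ∣ n + 1
      helper q∈ps with i , refl ← ∈-tabulate⁻ {f = p} q∈ps = p+1∣n+1 i

    length-primeDivisors : length (primeDivisors n) ≡ 2 + m
    length-primeDivisors = trans (↭-length (primeDivisors-product-↭ unique allPrime)) (length-tabulate p)

    degree-product : ∀ j → (∀ i → α (table i) ≤ α (table j)) → degree n ≡ α (table j)
    degree-product j α≤αⱼ = max≈v⁺ αⱼ∈ (All.map⁺ (All.tabulate bound)) z≤n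
      where
      αⱼ∈ : α (table j) ∈ map degreeAt (primeDivisors n)
      αⱼ∈ = subst (_∈ map degreeAt (primeDivisors n)) (degreeAt-p j)
        (∈-map⁺ degreeAt (∈-primeDivisors-product⁺ allPrime (∈-tabulate⁺ {f = p} j)))
      bound : ∀ {q} → q ∈ primeDivisors n → degreeAt q ≤ α (table j)
      bound q∈ with i , refl ← ∈-tabulate⁻ {f = p} (∈-primeDivisors-product⁻ allPrime q∈) =
        ≤-trans (≤-reflexive (degreeAt-p i)) (α≤αⱼ i)

    -- Turns arbitrarily large s into arbitrarily large n.
    s<product : 0 < first (table zero) → s < n
    s<product 0<k = begin-strict
      s                       <⟨ +-monoˡ-< s 0<k ⟩
      first (table zero) + s  ≤⟨ +-monoʳ-≤ (first (table zero)) (m≤m+n s _) ⟩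
      p zero                  ≤⟨ ∣⇒≤ {{productOfPrimes≢0 allPrime}} (∈⇒∣product {ns = ps} (here refl)) ⟩
      n                       ∎
      where open ≤-Reasoning

-- Counting witnesses, and exponential against polynomial growth.

module _ {P : ℕ → Set} (P? : Decidable P) where

  -- More than N positive integers cannot all be at most N. The search descends from x and must
  -- succeed before reaching N.
  largeWitness : ∀ N x → N < length (filter P? (applyUpTo suc x)) → ∃ λ m → N < m × P m
  largeWitness N zero    ()
  largeWitness N (suc x) N<count with N <? suc x | P? (suc x)
  ... | no N≮1+x | _       = contradiction (<-≤-trans N<count (≤-trans
    (length-filter P? (applyUpTo suc (suc x))) (≤-reflexive (length-applyUpTo suc (suc x))))) N≮1+x
  ... | yes N<1+x | yes p  = suc x , N<1+x , p
  ... | yes _     | no ¬p  = largeWitness N x (subst (N <_) (begin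
    length (filter P? (applyUpTo suc (suc x)))
      ≡⟨ cong (λ xs → length (filter P? xs)) (applyUpTo-∷ʳ suc x) ⟨
    length (filter P? (applyUpTo suc x ++ [ suc x ]))
      ≡⟨ cong length (filter-++ P? (applyUpTo suc x) [ suc x ]) ⟩
    length (found ++ filter P? [ suc x ])
      ≡⟨ length-++ found {filter P? [ suc x ]} ⟩
    length found + length (filter P? [ suc x ])
      ≡⟨ cong (λ xs → length found + length xs) (filter-reject P? ¬p) ⟩
    length found + 0
      ≡⟨ +-identityʳ _ ⟩
    length found
      ∎) N<count)
    where
    open ≡-Reasoning
    found = filter P? (applyUpTo suc x)

n<2^n : ∀ n → n < 2 ^ n
n<2^n zero    = s≤s z≤n
n<2^n (suc n) = begin-strict
  suc n              ≡⟨ +-comm 1 n ⟩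
  n + 1              <⟨ +-mono-<-≤ (n<2^n n) (m^n>0 2 n) ⟩
  2 ^ n + 2 ^ n      ≡⟨ cong (λ m → 2 ^ n + m) (+-identityʳ (2 ^ n)) ⟨
  2 * 2 ^ n          ∎
  where open ≤-Reasoning

[4+n]²≤2^[4+n] : ∀ n → (4 + n) * (4 + n) ≤ 2 ^ (4 + n)
[4+n]²≤2^[4+n] zero    = ≤-refl
[4+n]²≤2^[4+n] (suc n) = begin
  -- With i = 4 + n, the added term is 2 i² - (i + 1)² = (i - 1)² - 2.
  (5 + n) * (5 + n)                                       ≤⟨ m≤m+n _ (7 + n * n + 6 * n) ⟩
  (5 + n) * (5 + n) + (7 + n * n + 6 * n)                 ≡⟨ solve 1 (λ n →
    (con 5 :+ n) :* (con 5 :+ n) :+ (con 7 :+ n :* n :+ con 6 :* n)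
    := con 2 :* ((con 4 :+ n) :* (con 4 :+ n))) refl n ⟩
  2 * ((4 + n) * (4 + n))                                 ≤⟨ *-monoʳ-≤ 2 ([4+n]²≤2^[4+n] n) ⟩
  2 * 2 ^ (4 + n)                                         ∎
  where
  open ≤-Reasoning

module _ (k M : ℕ) where

  private
    -- The 4 is where 2 ^ i has caught up with i²; the summand k + M lets i² absorb M + i k.
    i = 4 + (k + M)

  -- For j = 2^i the two sides are M·2^(ik) and 2^(2^i), and M + ik ≤ i² ≤ 2^i.
  *-^<2^ : ∃ λ j → NonZero j × M * j ^ k < 2 ^ j
  *-^<2^ = 2 ^ i , m^n≢0 2 i , (begin-strict
    M * (2 ^ i) ^ k      ≡⟨ cong (M *_) (^-*-assoc 2 i k) ⟩
    M * 2 ^ (i * k)      <⟨ *-monoˡ-< (2 ^ (i * k)) {{m^n≢0 2 (i * k)}} (n<2^n M) ⟩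
    2 ^ M * 2 ^ (i * k)  ≡⟨ ^-distribˡ-+-* 2 M (i * k) ⟨
    2 ^ (M + i * k)      ≤⟨ ^-monoʳ-≤ 2 exponents ⟩
    2 ^ (2 ^ i)          ∎)
    where
    open ≤-Reasoning
    exponents : M + i * k ≤ 2 ^ i
    exponents = begin
      M + i * k              ≤⟨ +-monoˡ-≤ (i * k) (m≤m*n M i) ⟩
      M * i + i * k          ≡⟨ cong (λ m → M * i + m) (*-comm i k) ⟩
      M * i + k * i          ≡⟨ *-distribʳ-+ i M k ⟨
      (M + k) * i            ≤⟨ *-monoˡ-≤ i (≤-trans (≤-reflexive (+-comm M k)) (m≤n+m (k + M) 4)) ⟩
      i * i                  ≤⟨ [4+n]²≤2^[4+n] (k + M) ⟩
      2 ^ i                  ∎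

-- Natural numbers inside the rationals.

ι : ℕ → ℚ
ι n = + n ℚ./ 1

toℚᵘ-/ : ∀ i d → toℚᵘ (i ℚ./ suc d) ℚᵘ.≃ mkℚᵘ i d
toℚᵘ-/ i d = ℚ.toℚᵘ-fromℚᵘ (mkℚᵘ i d)

ι-* : ∀ m n → ι (m * n) ≡ ι m ℚ.* ι n
ι-* m n = ℚ.toℚᵘ-injective (ℚᵘ.≃-trans (toℚᵘ-/ (+ (m * n)) 0) (ℚᵘ.≃-sym
  (ℚᵘ.≃-trans (ℚ.toℚᵘ-homo-* (ι m) (ι n))
  (ℚᵘ.≃-trans (ℚᵘ.*-cong (toℚᵘ-/ (+ m) 0) (toℚᵘ-/ (+ n) 0))
    (*≡* (cong (ℤ._* 1ℤ) (sym (ℤ.pos-* m n))))))))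

ι-+ : ∀ m n → ι (m + n) ≡ ι m ℚ.+ ι n
ι-+ m n = ℚ.toℚᵘ-injective (ℚᵘ.≃-trans (toℚᵘ-/ (+ (m + n)) 0) (ℚᵘ.≃-sym
  (ℚᵘ.≃-trans (ℚ.toℚᵘ-homo-+ (ι m) (ι n))
  (ℚᵘ.≃-trans (ℚᵘ.+-cong (toℚᵘ-/ (+ m) 0) (toℚᵘ-/ (+ n) 0))
    (*≡* (cong (ℤ._* 1ℤ) (cong₂ ℤ._+_ (ℤ.*-identityʳ (+ m)) (ℤ.*-identityʳ (+ n)))))))))

ι-mono : ∀ {m n} → m ≤ n → ι m ℚ.≤ ι n
ι-mono {m} {n} m≤n = ℚ.toℚᵘ-cancel-≤
  (ℚᵘ.≤-respʳ-≃ (ℚᵘ.≃-sym (toℚᵘ-/ (+ n) 0)) (ℚᵘ.≤-respˡ-≃ (ℚᵘ.≃-sym (toℚᵘ-/ (+ m) 0))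
    (ℚᵘ.*≤* (ℤ.*-monoʳ-≤-nonNeg 1ℤ (ℤ.+≤+ m≤n)))))

0≤ι : ∀ n → 0ℚ ℚ.≤ ι n
0≤ι n = ι-mono {0} {n} z≤n

ι-nonNegative : ∀ n → ℚ.NonNegative (ι n)
ι-nonNegative n = ℚ.nonNegative (0≤ι n)

ι-cancel-≤ : ∀ m n → ι m ℚ.≤ ι n → m ≤ n
ι-cancel-≤ m n h
  with ℚᵘ.*≤* h′ ← ℚᵘ.≤-respʳ-≃ (toℚᵘ-/ (+ n) 0) (ℚᵘ.≤-respˡ-≃ (toℚᵘ-/ (+ m) 0) (ℚ.toℚᵘ-mono-≤ h)) =
  ℤ.drop‿+≤+ (subst₂ ℤ._≤_ (ℤ.*-identityʳ (+ m)) (ℤ.*-identityʳ (+ n)) h′)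

ι-*-inverse : ∀ n → ι (suc n) ℚ.* (+ 1 ℚ./ suc n) ≡ 1ℚ
ι-*-inverse n = ℚ.toℚᵘ-injective
  (ℚᵘ.≃-trans (ℚ.toℚᵘ-homo-* (ι (suc n)) (+ 1 ℚ./ suc n))
  (ℚᵘ.≃-trans (ℚᵘ.*-cong (toℚᵘ-/ (+ suc n) 0) (toℚᵘ-/ 1ℤ n))
    (*≡* (cong +_ eq))))
  where
  eq : suc n * 1 * 1 ≡ 1 * (1 * suc n)
  eq = solve 1 (λ n → (con 1 :+ n) :* con 1 :* con 1 := con 1 :* (con 1 :* (con 1 :+ n))) refl n

-- The denominator of δ serves as D, because a positive numerator is at least 1.
1≤ι*δ : ∀ {δ} → 0ℚ ℚ.< δ → ∃ λ D → 1ℚ ℚ.≤ ι D ℚ.* δ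
1≤ι*δ {δ@(mkℚ (+ suc n) d _)} _ = suc d , (begin
  1ℚ                                ≡⟨ ι-*-inverse d ⟨
  ι (suc d) ℚ.* (+ 1 ℚ./ suc d)     ≤⟨ ℚ.*-monoˡ-≤-nonNeg (ι (suc d)) {{ι-nonNegative (suc d)}} 1/≤δ ⟩
  ι (suc d) ℚ.* δ                   ∎)
  where
  open ℚ.≤-Reasoning
  1/≤δ : + 1 ℚ./ suc d ℚ.≤ δ
  1/≤δ = ℚ.toℚᵘ-cancel-≤ (ℚᵘ.≤-respˡ-≃ (ℚᵘ.≃-sym (toℚᵘ-/ 1ℤ d))
    (ℚᵘ.*≤* (ℤ.+≤+ (*-monoˡ-≤ (suc d) (s≤s (z≤n {n}))))))
1≤ι*δ {mkℚ (+ zero) _ _} (*<* (ℤ.+<+ ()))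
1≤ι*δ {mkℚ -[1+ _ ] _ _} (*<* ())

-- Upper bounds for logarithms of powers of 2.

-- Doubling x adds the terms 1/i with xN < i ≤ 2xN. There are xN of them, each at most 1/(xN).
riemannSum-2* : ∀ x N .{{_ : NonZero N}} .{{_ : NonZero x}} →
                riemannSum (2 * x) N ℚ.≤ 1ℚ ℚ.+ riemannSum x N
riemannSum-2* x N = begin
  harmonic (2 * x * N) ℚ.- harmonic N
    ≡⟨ cong (λ m → harmonic m ℚ.- harmonic N) (double x N) ⟩
  harmonic (x * N + x * N) ℚ.- harmonic N
    ≤⟨ ℚ.+-monoˡ-≤ (ℚ.- harmonic N) (step (x * N) {{m*n≢0 x N}}) ⟩
  (harmonic (x * N) ℚ.+ 1ℚ) ℚ.- harmonic N
    ≡⟨ ℚ-solve 3 (λ h o n → (h ⊞ o) ⊟ n ⊜ o ⊞ (h ⊟ n)) refl (harmonic (x * N)) 1ℚ (harmonic N) ⟩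
  1ℚ ℚ.+ (harmonic (x * N) ℚ.- harmonic N)
    ∎
  where
  open ℚ.≤-Reasoning
  double : ∀ x N → 2 * x * N ≡ x * N + x * N
  double = solve 2 (λ x N → con 2 :* x :* N := x :* N :+ x :* N) refl
  step : ∀ m .{{_ : NonZero m}} → harmonic (m + m) ℚ.≤ harmonic m ℚ.+ 1ℚ
  step m@(suc c) = subst (λ q → harmonic (m + m) ℚ.≤ harmonic m ℚ.+ q) (ι-*-inverse c)
    (harmonic-+-≤ m m {c} (n≤1+n c))

-- Valid at every step size, so that each rational approximation of log 2^j, and not just the limit,
-- is at most j.
riemannSum-2^ : ∀ j N .{{_ : NonZero N}} → riemannSum (2 ^ j) N ℚ.≤ ι j
riemannSum-2^ zero    N = ℚ.≤-reflexive (trans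
  (cong (λ m → harmonic m ℚ.- harmonic N) (*-identityˡ N)) (ℚ.+-inverseʳ (harmonic N)))
riemannSum-2^ (suc j) N = begin
  riemannSum (2 * 2 ^ j) N        ≤⟨ riemannSum-2* (2 ^ j) N {{it}} {{m^n≢0 2 j}} ⟩
  1ℚ ℚ.+ riemannSum (2 ^ j) N     ≤⟨ ℚ.+-monoʳ-≤ 1ℚ (riemannSum-2^ j N) ⟩
  1ℚ ℚ.+ ι j                      ≡⟨ ι-+ 1 j ⟨
  ι (suc j)                       ∎
  where open ℚ.≤-Reasoning

*-mono-ℚ : ∀ {p q r s} → 0ℚ ℚ.≤ p → 0ℚ ℚ.≤ s → p ℚ.≤ q → r ℚ.≤ s → p ℚ.* r ℚ.≤ q ℚ.* s
*-mono-ℚ {p} {q} {r} {s} 0≤p 0≤s p≤q r≤s = ℚ.≤-trans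
  (ℚ.*-monoˡ-≤-nonNeg p {{ℚ.nonNegative 0≤p}} r≤s)
  (ℚ.*-monoʳ-≤-nonNeg s {{ℚ.nonNegative 0≤s}} p≤q)

^ℝ-approx-≤ : ∀ x n {j} → 0ℚ ℚ.≤ approx x n → approx x n ℚ.≤ ι j → ∀ k → approx (x ^ℝ k) n ℚ.≤ ι (j ^ k)
^ℝ-approx-≤ x n {j} 0≤x x≤j zero    = ℚ.≤-refl
^ℝ-approx-≤ x n {j} 0≤x x≤j (suc k) = ℚ.≤-trans
  (*-mono-ℚ 0≤x (0≤ι (j ^ k)) x≤j (^ℝ-approx-≤ x n {j} 0≤x x≤j k))
  (ℚ.≤-reflexive (sym (ι-* j (j ^ k))))

-- From the asymptotic formula to unboundedness of the count.

-- The hypothesis yields q - p ≤ q/2 + 1, hence q/2 ≤ p + 1.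
≤½+⇒≤ : ∀ {p q} → 0ℚ ℚ.≤ q → ℚ.∣ p ℚ.- q ∣ ℚ.≤ ½ ℚ.* ℚ.∣ q ∣ ℚ.+ 1ℚ → q ℚ.≤ ι 2 ℚ.* (p ℚ.+ 1ℚ)
≤½+⇒≤ {p} {q} 0≤q h = begin
  q                                                  ≡⟨ ℚ-solve 2 (λ p q →
    q ⊜ κ (ι 2) ⊠ (q ⊟ p) ⊟ q ⊞ κ (ι 2) ⊠ p) refl p q ⟩
  ι 2 ℚ.* (q ℚ.- p) ℚ.- q ℚ.+ ι 2 ℚ.* p              ≤⟨ ℚ.+-monoˡ-≤ (ι 2 ℚ.* p) (ℚ.+-monoˡ-≤ (ℚ.- q)
                                                          (ℚ.*-monoˡ-≤-nonNeg (ι 2) {{ι-nonNegative 2}} q-p≤)) ⟩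
  ι 2 ℚ.* (½ ℚ.* q ℚ.+ 1ℚ) ℚ.- q ℚ.+ ι 2 ℚ.* p       ≡⟨ ℚ-solve 2 (λ p q →
    κ (ι 2) ⊠ (κ ½ ⊠ q ⊞ κ 1ℚ) ⊟ q ⊞ κ (ι 2) ⊠ p ⊜ κ (ι 2) ⊠ (p ⊞ κ 1ℚ)) refl p q ⟩
  ι 2 ℚ.* (p ℚ.+ 1ℚ)                                 ∎
  where
  open ℚ.≤-Reasoning
  p≤∣p∣ : ∀ p → p ℚ.≤ ℚ.∣ p ∣
  p≤∣p∣ p with ℚ.≤-total 0ℚ p
  ... | inj₁ 0≤p = ℚ.≤-reflexive (sym (ℚ.0≤p⇒∣p∣≡p 0≤p))
  ... | inj₂ p≤0 = ℚ.≤-trans p≤0 (ℚ.0≤∣p∣ p)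
  q-p≤ : q ℚ.- p ℚ.≤ ½ ℚ.* q ℚ.+ 1ℚ
  q-p≤ = begin
    q ℚ.- p                      ≤⟨ p≤∣p∣ (q ℚ.- p) ⟩
    ℚ.∣ q ℚ.- p ∣                ≡⟨ cong ℚ.∣_∣ (ℚ-solve 2 (λ p q → q ⊟ p ⊜ ⊟ (p ⊟ q)) refl p q) ⟩
    ℚ.∣ ℚ.- (p ℚ.- q) ∣          ≡⟨ ℚ.∣-p∣≡∣p∣ (p ℚ.- q) ⟩
    ℚ.∣ p ℚ.- q ∣                ≤⟨ h ⟩
    ½ ℚ.* ℚ.∣ q ∣ ℚ.+ 1ℚ         ≡⟨ cong (λ r → ½ ℚ.* r ℚ.+ 1ℚ) (ℚ.0≤p⇒∣p∣≡p 0≤q) ⟩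
    ½ ℚ.* q ℚ.+ 1ℚ               ∎

-- The asymptotic relation at a single approximation index: F is the count, c and P stand for
-- approximations of the constant and of the power of log x, and g for that of the main term. Then x
-- ≤ D c x = D g P, where g ≤ 2 (F + 1).
quotient-bound : ∀ F N x y D {c δ P : ℚ} → 0ℚ ℚ.< δ → 1ℚ ℚ.≤ ι D ℚ.* δ → δ ℚ.≤ c →
                 0ℚ ℚ.< P → P ℚ.≤ ι y →
                 let g = c ℚ.* ι x ℚ.* recip P in
                 ℚ.∣ ι F ℚ.- g ∣ ℚ.≤ ½ ℚ.* ℚ.∣ g ∣ ℚ.+ 1ℚ →
                 F ≤ N → x ≤ D * (2 * (N + 1) * y)
quotient-bound F N x y D {c} {δ} {P} 0<δ 1≤Dδ δ≤c 0<P P≤y F≈g F≤N = ι-cancel-≤ x _ (begin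
  ι x                                      ≡⟨ ℚ.*-identityˡ (ι x) ⟨
  1ℚ ℚ.* ι x                               ≤⟨ ℚ.*-monoʳ-≤-nonNeg (ι x) {{ι-nonNegative x}} 1≤Dδ ⟩
  ι D ℚ.* δ ℚ.* ι x                        ≡⟨ ℚ.*-assoc (ι D) δ (ι x) ⟩
  ι D ℚ.* (δ ℚ.* ι x)                      ≤⟨ ℚ.*-monoˡ-≤-nonNeg (ι D) {{ι-nonNegative D}}
                                                (ℚ.*-monoʳ-≤-nonNeg (ι x) {{ι-nonNegative x}} δ≤c) ⟩
  ι D ℚ.* (c ℚ.* ι x)                      ≡⟨ cong (ι D ℚ.*_) g*P ⟨
  ι D ℚ.* (g ℚ.* P)                        ≤⟨ ℚ.*-monoˡ-≤-nonNeg (ι D) {{ι-nonNegative D}}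
                                                (*-mono-ℚ 0≤g (0≤ι y) g≤ P≤y) ⟩
  ι D ℚ.* (ι (2 * (N + 1)) ℚ.* ι y)        ≡⟨ cong (ι D ℚ.*_) (ι-* (2 * (N + 1)) y) ⟨
  ι D ℚ.* ι (2 * (N + 1) * y)              ≡⟨ ι-* D (2 * (N + 1) * y) ⟨
  ι (D * (2 * (N + 1) * y))                ∎)
  where
  open ℚ.≤-Reasoning
  g = c ℚ.* ι x ℚ.* recip P

  0≤cx : 0ℚ ℚ.≤ c ℚ.* ι x
  0≤cx = subst (ℚ._≤ c ℚ.* ι x) (ℚ.*-zeroˡ (ι x))
    (ℚ.*-monoʳ-≤-nonNeg (ι x) {{ι-nonNegative x}} (ℚ.≤-trans (ℚ.<⇒≤ 0<δ) δ≤c))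

  0≤g : 0ℚ ℚ.≤ g
  0≤g = subst (ℚ._≤ g) (ℚ.*-zeroˡ (recip P))
    (ℚ.*-monoʳ-≤-nonNeg (recip P) {{ℚ.nonNegative (ℚ.<⇒≤ (recip-pos 0<P))}} 0≤cx)

  g*P : g ℚ.* P ≡ c ℚ.* ι x
  g*P = trans (ℚ.*-assoc (c ℚ.* ι x) (recip P) P)
    (trans (cong (c ℚ.* ι x ℚ.*_) (trans (ℚ.*-comm (recip P) P)
             (recip-inverseʳ P (λ P≡0 → ℚ.<⇒≢ 0<P (sym P≡0)))))
           (ℚ.*-identityʳ (c ℚ.* ι x)))

  g≤ : g ℚ.≤ ι (2 * (N + 1))
  g≤ = begin
    g                         ≤⟨ ≤½+⇒≤ {p = ι F} 0≤g F≈g ⟩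
    ι 2 ℚ.* (ι F ℚ.+ 1ℚ)      ≡⟨ cong (ι 2 ℚ.*_) (ι-+ F 1) ⟨
    ι 2 ℚ.* ι (F + 1)         ≡⟨ ι-* 2 (F + 1) ⟨
    ι (2 * (F + 1))           ≤⟨ ι-mono (*-monoʳ-≤ 2 (+-monoˡ-≤ 1 F≤N)) ⟩
    ι (2 * (N + 1))           ∎

0<ℝ⇒0<approx : ∀ x → (0<x : 0ℝ <ℝ x) → ∀ n → proj₁ (proj₂ (proj₂ 0<x)) ≤ n → 0ℚ ℚ.< approx x n
0<ℝ⇒0<approx x (δ , 0<δ , _ , δ≤x) n N≤n = ℚ.<-≤-trans 0<δ
  (subst (ℚ._≤ approx x n) (ℚ.+-identityˡ δ) (δ≤x n N≤n))

log-2^-≤ : ∀ j n .{{_ : NonZero (2 ^ j)}} → approx (log (2 ^ j)) n ℚ.≤ ι j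
log-2^-≤ j n = riemannSum-2^ j (suc n)

module _ (f : ℕ → ℕ) (c : ℝ) (k : ℕ) (0<c : 0ℝ <ℝ c)
         (f∼ : (λ x → fromℕ (f x)) ∼ mainTerm c k) where

  private
    δ = proj₁ 0<c
    0<δ = proj₁ (proj₂ 0<c)
    D = proj₁ (1≤ι*δ 0<δ)
    X = proj₁ (f∼ ½ (ℚ.positive⁻¹ ½))

  -- For large x, f x ≥ ½ c x / logᵏ x - 1, and along x = 2^j the logarithm is at most j.
  bounded⇒x≤ : ∀ N j .{{_ : NonTrivial (2 ^ j)}} → X ≤ 2 ^ j → f (2 ^ j) ≤ N →
               2 ^ j ≤ D * (2 * (N + 1) * j ^ k)
  -- Each of the four estimates holds from some index on; the maximum of the thresholds serves them
  -- all.
  bounded⇒x≤ N j X≤x fx≤N = at (n₁ ⊔ n₂ ⊔ (n₃ ⊔ n₄))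
    (≤-trans (m≤m⊔n n₁ n₂) (m≤m⊔n (n₁ ⊔ n₂) (n₃ ⊔ n₄)))
    (≤-trans (m≤n⊔m n₁ n₂) (m≤m⊔n (n₁ ⊔ n₂) (n₃ ⊔ n₄)))
    (≤-trans (m≤m⊔n n₃ n₄) (m≤n⊔m (n₁ ⊔ n₂) (n₃ ⊔ n₄)))
    (≤-trans (m≤n⊔m n₃ n₄) (m≤n⊔m (n₁ ⊔ n₂) (n₃ ⊔ n₄)))
    where
    x = 2 ^ j
    L = log x {{nonTrivial⇒nonZero x}}

    -- Relative error ½ in `∼` and slack 1 in `≤ℝ` are enough for unboundedness.
    close = proj₂ (f∼ ½ (ℚ.positive⁻¹ ½)) x X≤x 1ℚ (ℚ.positive⁻¹ 1ℚ)
    0<L = log-pos x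
    0<L^k = ^ℝ-pos L 0<L k

    n₁ = proj₁ close
    n₂ = proj₁ (proj₂ (proj₂ 0<c))
    n₃ = proj₁ (proj₂ (proj₂ 0<L))
    n₄ = proj₁ (proj₂ (proj₂ 0<L^k))

    at : ∀ n → n₁ ≤ n → n₂ ≤ n → n₃ ≤ n → n₄ ≤ n → x ≤ D * (2 * (N + 1) * j ^ k)
    at n n₁≤n n₂≤n n₃≤n n₄≤n = quotient-bound (f x) N x (j ^ k) D
      {approx c n} {δ} {approx (L ^ℝ k) n} 0<δ (proj₂ (1≤ι*δ 0<δ))
      (subst (ℚ._≤ approx c n) (ℚ.+-identityˡ δ) (proj₂ (proj₂ (proj₂ 0<c)) n n₂≤n))
      (0<ℝ⇒0<approx (L ^ℝ k) 0<L^k n n₄≤n)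
      (^ℝ-approx-≤ L n {j} (ℚ.<⇒≤ (0<ℝ⇒0<approx L 0<L n n₃≤n))
        (log-2^-≤ j n {{nonTrivial⇒nonZero x}}) k)
      (proj₂ close n n₁≤n) fx≤N

  -- If f (2 ^ j) ≤ N, then 2 ^ j is at most a constant multiple of j ^ k, which fails for a
  -- suitable j.
  ∼mainTerm⇒unbounded : ∀ N → ∃ λ x → N < f x
  -- Adding X to the constant makes the same j also satisfy X ≤ 2 ^ j.
  ∼mainTerm⇒unbounded N = along (*-^<2^ k (D * (2 * (N + 1)) + X))
    where
    along : (∃ λ j → NonZero j × (D * (2 * (N + 1)) + X) * j ^ k < 2 ^ j) → ∃ λ x → N < f x
    along (j , j≢0 , x-large) = 2 ^ j , ≰⇒> λ fx≤N → <⇒≱ x-large (≤-trans (bounded⇒x≤ N j X≤x fx≤N)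
      (≤-trans (≤-reflexive (sym (*-assoc D (2 * (N + 1)) (j ^ k))))
        (*-monoˡ-≤ (j ^ k) (m≤m+n (D * (2 * (N + 1))) X))))
      where
      instance
        2^j>1 : NonTrivial (2 ^ j)
        2^j>1 = n>1⇒nonTrivial (^-monoʳ-≤ 2 (>-nonZero⁻¹ j {{j≢0}}))

      X≤x : X ≤ 2 ^ j
      X≤x = ≤-trans (m≤n+m X (D * (2 * (N + 1))))
        (≤-trans (m≤m*n (D * (2 * (N + 1)) + X) (j ^ k) {{m^n≢0 j k {{j≢0}}}}) (<⇒≤ x-large))

-- The conjecture applied to the forms a t - 1.

prime∣∏⇒prime∣factor : ∀ {p l} (f : Fin l → ℤ) → Prime p → + p ℤ.∣ Vector.foldr ℤ._*_ 1ℤ f →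
                       ∃ λ i → + p ℤ.∣ f i
prime∣∏⇒prime∣factor {l = zero}  f pp p∣1 = contradiction (subst Prime (∣1⇒≡1 p∣1) pp) ¬prime[1]
prime∣∏⇒prime∣factor {p} {suc l} f pp p∣Π
  with euclidsLemma ℤ.∣ f zero ∣ _ pp (subst (p ∣_) (ℤ.abs-* (f zero) _) p∣Π)
... | inj₁ p∣f₀ = zero , p∣f₀
... | inj₂ p∣Π′ with i , p∣fᵢ ← prime∣∏⇒prime∣factor (λ i → f (suc i)) pp p∣Π′ = suc i , p∣fᵢ

-- The candidate is a t - 1 with a = k + 1 and t = s + 1, expressed without subtraction.
suc-candidate : ∀ k s → suc (candidate k s) ≡ suc k * suc s
suc-candidate k s = solve 2 (λ k s →
  con 1 :+ (k :+ (con 1 :+ k :+ con 0) :* s) := (con 1 :+ k) :* (con 1 :+ s)) refl k s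

module _ {k : ℕ} (first : Fin k → ℕ) (distinct : ∀ i j → first i ≡ first j → i ≡ j) where

  private
    a : Fin k → ℕ
    a i = suc (first i)

    b : Fin k → ℤ
    b _ = -1ℤ

    form-suc : ∀ i s → form a b i (suc s) ≡ + candidate (first i) s
    form-suc i s = cong (λ m → + m ℤ.+ -1ℤ) (sym (suc-candidate (first i) s))

  -- At m = p every form is ≡ -1 modulo p.
  noFixedDivisor : ¬ ∃ λ p → Prime p × (∀ m → 1 ≤ m → + p ℤ.∣ formProduct a b m)
  noFixedDivisor (zero  , pp , _)    = contradiction pp ¬prime[0]
  noFixedDivisor (suc p , pp , p∣f) =
    -- The prime is `suc p`, so m = `suc p` corresponds to s = `p`; it would divide both v and v +
    -- 1.
    let i , p∣form = prime∣∏⇒prime∣factor (λ i → form a b i (suc p)) pp (p∣f (suc p) (s≤s z≤n))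
        v = candidate (first i) p
        p∣v = subst (+ suc p ℤ.∣_) (form-suc i p) p∣form
        p∣v+1 = subst (suc p ∣_) (trans (sym (suc-candidate (first i) p)) (+-comm 1 v))
                  (n∣m*n (suc (first i)))
    in ¬prime[1] (subst Prime (∣1⇒≡1 (∣m+n∣m⇒∣n p∣v+1 p∣v)) pp)

  private
    largeCandidates : ∀ N → (∃ λ m → N < m × AllPrime a b m) →
                      ∃ λ s → N ≤ s × (∀ i → Prime (candidate (first i) s))
    largeCandidates N (suc s , s≤s N≤s , primes) =
      s , N≤s , λ i → subst Primeℤ⁺ (form-suc i s) (primes i)

    largeTuple : ∀ N → (∃ λ c → 0ℝ <ℝ c × (λ x → fromℕ (primeTupleCount a b x)) ∼ mainTerm c k) →
                 ∃ λ m → N < m × AllPrime a b m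
    largeTuple N (c , 0<c , asymptotics) =
      let x , N<count = ∼mainTerm⇒unbounded (primeTupleCount a b) c k 0<c asymptotics N
      in largeWitness (allPrime? a b) N x N<count

  -- All constant terms are -1, so the forms are distinct because their leading coefficients are.
  primeCandidates : PrimeKTuplesConjecture → .{{_ : NonZero k}} →
                    ∀ N → ∃ λ s → N ≤ s × (∀ i → Prime (candidate (first i) s))
  primeCandidates conjecture N = largeCandidates N (largeTuple N
    (conjecture k a (λ _ → s≤s z≤n) b (λ _ ())
      (λ {i} {j} eq → distinct i j (suc-injective (cong proj₁ eq))) noFixedDivisor))

module _ {m} (table : Fin (2 + m) → Row)
  (distinct : ∀ i j → first (table i) ≡ first (table j) → i ≡ j) where

  open Family table distinct

  -- The first row is required to have the largest α, so that it determines the degree.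
  infinitelyManyLucasCarmichael :
    (∀ i → IsExpansion N (poly i) (α (table i)) (digits (table i))) →
    0 < first (table zero) → (∀ i → α (table i) ≤ α (table zero)) →
    PrimeKTuplesConjecture → ∀ M →
    ∃ λ n → M < n × LucasCarmichael n × degree n ≡ α (table zero) × length (primeDivisors n) ≡ 2 + m
  infinitelyManyLucasCarmichael expansions 0<k α≤α₀ conjecture M =
    conclude (primeCandidates (λ i → first (table i)) distinct conjecture M)
    where
    conclude : (∃ λ s → M ≤ s × (∀ i → Prime (candidate (first (table i)) s))) →
               ∃ λ n → M < n × LucasCarmichael n × degree n ≡ α (table zero) × length (primeDivisors n) ≡ 2 + m
    conclude (s , M≤s , primes) =
      product (tabulate (λ i → candidate (first (table i)) s)) ,
      ≤-<-trans M≤s (s<product expansions s primes 0<k) ,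
      lucasCarmichael expansions s primes ,
      degree-product expansions s primes zero α≤α₀ ,
      length-primeDivisors expansions s primes

-- The seven multipliers and their digit tables.

-- a t ± c as a polynomial in s = t − 1; the subtraction is never truncated below.
_t+_ _t-_ : ℕ → ℕ → Poly
a t+ c = a + c ∷ a ∷ []
a t- c = a ∸ c ∷ a ∷ []

infix 8 _t+_ _t-_

-- The multipliers were found by a search among the 7-element sets of divisors of some L whose
-- sum (here L = 72) is a multiple of L. The factor 62208 = 2⁸·3⁵ makes all digits integral,
-- and the digits were read off from those of n + 2 for two values of t.
table : Fin 7 → Row
table = lookup (
  row (62208 * 3 ∸ 1) 4
      (186624 t- 12933 ∷ 62208 t+ 64180 ∷ 145152 t- 135687 ∷ [ 158429 ] ∷
       165888 t- 110316 ∷ [ 45800 ] ∷ 186624 t- 10495 ∷ [ 1023 ] ∷ []) ∷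
  row (62208 * 4 ∸ 1) 4
      (132192 t- 3282 ∷ 159408 t+ 14987 ∷ 221616 t- 29065 ∷ 136080 t+ 31049 ∷
       34992 t- 19727 ∷ 139968 t+ 7452 ∷ 171072 t- 1549 ∷ [ 136 ] ∷ []) ∷
  row (62208 * 6 ∸ 1) 3
      (124416 t- 581 ∷ 145152 t+ 2307 ∷ 51840 t- 3859 ∷ 321408 t+ 3538 ∷
       103680 t- 1919 ∷ [ 615 ] ∷ 373248 t- 107 ∷ [ 7 ] ∷ []) ∷
  row (62208 * 8 ∸ 1) 2
      (208008 t- 197 ∷ 93798 t+ 699 ∷ 250047 t- 1032 ∷ 45198 t+ 831 ∷
       196344 t- 394 ∷ 168156 t+ 110 ∷ 33777 t- 17 ∷ [ 1 ] ∷ []) ∷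
  row (62208 * 9 ∸ 1) 4
      (217344 t- 131 ∷ 136192 t+ 443 ∷ 470784 t- 618 ∷ 431360 t+ 470 ∷
       371456 t- 210 ∷ 350208 t+ 55 ∷ 262144 t- 8 ∷ []) ∷
  row (62208 * 18 ∸ 1) 4
      (250368 t- 17 ∷ 287488 t+ 44 ∷ 1009536 t- 41 ∷ 828032 t+ 21 ∷
       1084160 t- 6 ∷ 1015296 t+ 1 ∷ 4096 t- 1 ∷ []) ∷
  row (62208 * 24 ∸ 1) 3
      (787320 t- 8 ∷ 701622 t+ 20 ∷ 285363 t- 16 ∷ 931338 t+ 7 ∷
       302940 t- 2 ∷ 1469664 t+ 1 ∷ 729 t- 1 ∷ []) ∷ []
  )

table-distinct : ∀ i j → first (table i) ≡ first (table j) → i ≡ j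
table-distinct = from-yes (all? λ i → all? λ j → (first (table i) ≟ first (table j)) →-dec (i Fin.≟ j))

open Family table table-distinct

-- Decided by computing with coefficient lists; evaluation then gives the expansions for all s at
-- once.
table-expansions : ∀ i → IsExpansion N (poly i) (α (table i)) (digits (table i))
table-expansions = from-yes (all? λ i →
  isExpansion? N (poly i) (α (table i)) (digits (table i)))

theorem4p5 : PrimeKTuplesConjecture →
    ∀ (N : ℕ) → ∃ λ n → N < n × LucasCarmichael n × degree n ≡ 4 × length (primeDivisors n) ≡ 7
theorem4p5 = infinitelyManyLucasCarmichael table table-distinct table-expansions
  (from-yes (0 <? first (table zero))) (from-yes (all? λ i → α (table i) ≤? α (table zero)))
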